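{- Let $\mathcal R$ be a left-linear TRS. A peak $s\ {\multimap\!\!\!\!- }_{\Phi}^{ -1}\ t \multimap_{\Psi} u$ (i.e. multisteps $\Phi:t\multimap s$ and $\Psi:t\multimap u$) of overlapping multisteps either is critical, or it can be vertically decomposed: there are variables $\vec x=x_1,\dots,x_n$ and peaks $\Phi_i:t_i\multimap s_i$, $\Psi_i:t_i\multimap u_i$ for $0\le i\le n$ such that $$\Phi=\Phi_0[\vec x:=\vec\Phi],\quad \Psi=\Psi_0[\vec x:=\vec\Psi],\quad s=s_0[\vec x:=\vec s],\quad t=t_0[\vec x:=\vec t],\quad u=u_0[\vec x:=\vec u]$$ (where $\vec\Phi=\Phi_1,\dots,\Phi_n$, and similarly for $\vec\Psi,\vec s,\vec t,\vec u$), and such that $\Phi\Cap\Psi\ \ge\ \Phi_i\Cap\Psi_i$ and $\Phi\Cup\Psi\ >\ \Phi_i\Cup\Psi_i$ for all $0\le i\le n$.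
   Context: **Terms.** Terms are built from function symbols, 2nd-order variables $X,Y,\dots$ (each with an arity) and 1st-order variables $x,y,\dots$; a 1st-order term contains no 2nd-order variables. For each rule $\varrho$ of $\mathcal R$ there is a rule symbol, written $\varrho(\vec x):\ell\to r$ with $\vec x$ the variables of $\ell$ in order of occurrence. **Multipatterns and multisteps.** Consider let-expressions $\mathsf{let}\ X_1,\dots,X_n=\lambda\vec x_1.s_1,\dots,\lambda\vec x_n.s_n\ \mathsf{in}\ M$ ($n\ge 0$) with pairwise distinct 2nd-order variables $X_i$, closed $\lambda\vec x_i.s_i$ with $|\vec x_i|$ the arity of $X_i$, and $M$ (the body) a term with 2nd-order variables among the $X_i$, that are linear (each $X_i$ occurs exactly once in $M$ and each variable of $\vec x_i$ exactly once in $s_i$) and canonical ($X_i$'s listed in order of occurrence in the pre-order walk of $M$, and likewise $\vec x_i$ in $s_i$), up to renaming of bound variables; the $\lambda$-prefixes are usually omitted. Such an expression is a multipattern if each $s_i$ is a non-variable 1st-order term, and a multistep of $\mathcal R$ if each $s_i$ has shape $\varrho(\vec x_i)$ for a rule symbol $\varrho$ of $\mathcal R$. The denotation $[\![\cdot]\!]$ is the result of 2nd-order substituting $\lambda\vec x_i.s_i$ for $X_i$ in $M$. For a multistep $\Phi=\mathsf{let}\ \vec X=\vec{\varrho(\vec x)}\ \mathsf{in}\ M$ with rules $\varrho_i(\vec x_i):\ell_i\to r_i$, $\mathsf{src}(\Phi)=\mathsf{let}\ \vec X=\vec\ell\ \mathsf{in}\ M$ (a multipattern by left-linearity) and $\mathsf{tgt}(\Phi)=\mathsf{let}\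 \vec X=\vec r\ \mathsf{in}\ M$; $\Phi:t\multimap s$ means $t=[\![\mathsf{src}(\Phi)]\!]$ and $s=[\![\mathsf{tgt}(\Phi)]\!]$. Substitution $\Phi_0[\vec x:=\vec\Phi]$ substitutes the bodies of $\vec\Phi$ for the 1st-order variables $\vec x$ in the body of $\Phi_0$ and combines the let-bindings (renamed apart, canonically reordered). **Refinement lattice.** For multipatterns $\varsigma=\mathsf{let}\ \vec X=\vec s\ \mathsf{in}\ M$ and $\zeta=\mathsf{let}\ \vec Y=\vec u\ \mathsf{in}\ N$, $\varsigma\sqsubseteq\zeta$ if there is a 2nd-order substitution $\sigma$ on $\vec Y$ with $N^\sigma=M$ and $[\![\mathsf{let}\ \vec X=\vec s\ \mathsf{in}\ (Y_i(\vec y_i))^\sigma]\!]=u_i$ for all $i$, with $\vec y_i$ the variables of $u_i$. On multipatterns denoting a fixed 1st-order term, $\sqsubseteq$ is a finite distributive lattice with meet $\sqcap$, join $\sqcup$, least element $\bot$ and greatest element $\top$. **Sizes and overlap.** $\|t\|$ is the pair consisting of the number of symbols in $t$ that are not 1st-order variables, and the sum over the 1st-order variables $x$ of the square of the number of occurrences of $x$ in $t$. Pairs are compared by the lexicographic order $>$ ($\ge$ its reflexive closure). For a multipattern $\varsigma=\mathsf{let}\ \vec X=\vec s\ \mathsf{in}\ M$, its pattern-size is the componentwise sum $\sum_i\|s_i\|$ (empty sum $(0,0)$), its body-size is $\|M\|$. For multipatterns $\varsigma,\zeta$ denoting the same term, $\varsigma\Cap\zeta$ (amount of overlap) is the pattern-size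 of $\varsigma\sqcap\zeta$, and $\varsigma\Cup\zeta$ (amount of non-overlap) is the body-size of $\varsigma\sqcup\zeta$. They are overlapping if $\varsigma\sqcap\zeta\neq\bot$, and critically overlapping if moreover $\varsigma\sqcup\zeta=\top$ and the denoted term $[\![\varsigma]\!]=[\![\zeta]\!]$ is linear. For a peak of multisteps $\Phi,\Psi$ with the same source term, these notions ($\Phi\Cap\Psi$, $\Phi\Cup\Psi$, overlapping, critical) are defined via $\mathsf{src}(\Phi),\mathsf{src}(\Psi)$. -}

module Defs where

open import Data.Bool.Base using (if_then_else_)
open import Data.Empty using (⊥)
open import Data.Fin.Base using (Fin)
import Data.Fin.Properties as Fin
open import Data.List.Base
  using (List; []; _∷_; _++_; map; length; filter; deduplicate; allFin; foldr)
open import Data.List.Membership.Propositional using (_∈_; mapWith∈)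
open import Data.List.Membership.Propositional.Properties
  using (∈-++⁺ˡ; ∈-++⁺ʳ; map-mapWith∈)
open import Data.List.Properties using (filter-all; map-++; map-∘)
open import Data.List.Relation.Unary.All as All using (All; []; _∷_)
import Data.List.Relation.Unary.All.Properties as All
open import Data.List.Relation.Unary.Any using (here; there)
open import Data.List.Relation.Unary.AllPairs using ([]; _∷_)
open import Data.List.Relation.Unary.Unique.Propositional using (Unique)
open import Data.Nat.Base using (ℕ; suc; _+_; _^_; _>_)
open import Data.Nat.ListAction using (sum)
import Data.Nat.Properties as ℕ
open import Data.Product.Base
  using (∃; ∃₂; _×_; _,_; proj₁; proj₂; Σ-syntax; ∃-syntax; zip)
open import Data.Product.Relation.Binary.Lex.Strict using (×-Lex)
open import Data.Vec.Base as Vec using (Vec; []; _∷_; lookup)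
open import Function.Base using (_∘_; id)
open import Relation.Binary.Construct.Closure.Reflexive using (ReflClosure)
open import Relation.Binary.Definitions using (DecidableEquality; Maximum; Minimum)
open import Relation.Binary.PropositionalEquality
  using (_≡_; refl; sym; trans; cong; cong₂; module ≡-Reasoning)
open import Relation.Nullary.Decidable.Core using (does; ¬?)
open import Relation.Nullary.Negation.Core using (¬_)

Size : Set
Size = ℕ × ℕ

infix 4 _>ₛ_ _≥ₛ_

_>ₛ_ _≥ₛ_ : Size → Size → Set
_>ₛ_ = ×-Lex _≡_ _>_ _>_
_≥ₛ_ = ReflClosure _>ₛ_

Σₛ : List Size → Size
Σₛ = foldr (zip _+_ _+_) (0 , 0)

-- All 2nd-order variables of the context Γ, in order; a 2nd-order variable is
-- a position in the list Γ of arities.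
allMetas : (Γ : List ℕ) → List (∃ (_∈ Γ))
allMetas Γ = mapWith∈ Γ (λ {k} X → k , X)

-- Sym k is the set of function symbols of arity k.
module Rewriting (Sym : ℕ → Set) where

  infixl 8 _[_≔ₜ_] _[_≔ₗ_]
  infix  6 _≔_
  infix  4 _⊑_

  -- 𝒳 k is the set of 2nd-order variables of arity k, and V the set of
  -- 1st-order variables.
  data Term (𝒳 : ℕ → Set) (V : Set) : Set where
    var  : V → Term 𝒳 V
    fn   : ∀ {k} → Sym k → Vec (Term 𝒳 V) k → Term 𝒳 V
    meta : ∀ {k} → 𝒳 k → Vec (Term 𝒳 V) k → Term 𝒳 V

  -- 1st-order terms. An element of FO (Fin k) stands for the closed λ x₁…x_k.s.
  FO : Set → Set
  FO = Term (λ _ → ⊥)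

  data NonVar {𝒳 V} : Term 𝒳 V → Set where
    fn   : ∀ {k} (f : Sym k) ts → NonVar (fn f ts)
    meta : ∀ {k} (X : 𝒳 k) ts → NonVar (meta X ts)

  module _ {𝒳 : ℕ → Set} {V : Set} where

    -- Occurrences of 1st-order variables, from left to right.
    vars  : Term 𝒳 V → List V
    vars* : ∀ {k} → Vec (Term 𝒳 V) k → List V
    vars (var x)     = x ∷ []
    vars (fn f ts)   = vars* ts
    vars (meta X ts) = vars* ts
    vars* []       = []
    vars* (t ∷ ts) = vars t ++ vars* ts

    -- Occurrences of 2nd-order variables, in the pre-order walk.
    metas  : Term 𝒳 V → List (∃ 𝒳)
    metas* : ∀ {k} → Vec (Term 𝒳 V) k → List (∃ 𝒳)
    metas (var x)     = []
    metas (fn f ts)   = metas* ts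
    metas (meta X ts) = (_ , X) ∷ metas* ts
    metas* []       = []
    metas* (t ∷ ts) = metas t ++ metas* ts

    Linear : Term 𝒳 V → Set
    Linear t = Unique (vars t)

    symbols  : Term 𝒳 V → ℕ
    symbols* : ∀ {k} → Vec (Term 𝒳 V) k → ℕ
    symbols (var x)     = 0
    symbols (fn f ts)   = suc (symbols* ts)
    symbols (meta X ts) = suc (symbols* ts)
    symbols* []       = 0
    symbols* (t ∷ ts) = symbols t + symbols* ts

    size : DecidableEquality V → Term 𝒳 V → Size
    size _≟_ t =
      symbols t ,
      sum (map (λ x → length (filter (x ≟_) (vars t)) ^ 2)
               (deduplicate _≟_ (vars t)))

  module _ {𝒳 : ℕ → Set} {V W : Set} (σ : V → Term 𝒳 W) where

    bind  : Term 𝒳 V → Term 𝒳 W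
    bind* : ∀ {k} → Vec (Term 𝒳 V) k → Vec (Term 𝒳 W) k
    bind (var x)     = σ x
    bind (fn f ts)   = fn f (bind* ts)
    bind (meta X ts) = meta X (bind* ts)
    bind* []       = []
    bind* (t ∷ ts) = bind t ∷ bind* ts

  _≔_ : ∀ {𝒳 n} → Vec ℕ n → Vec (Term 𝒳 ℕ) n → ℕ → Term 𝒳 ℕ
  ([]     ≔ [])     y = var y
  ((x ∷ xs) ≔ (t ∷ ts)) y = if does (y ℕ.≟ x) then t else (xs ≔ ts) y

  _[_≔ₜ_] : ∀ {𝒳 n} → Term 𝒳 ℕ → Vec ℕ n → Vec (Term 𝒳 ℕ) n → Term 𝒳 ℕ
  t [ xs ≔ₜ ts ] = bind (xs ≔ ts) t

  module _ {𝒳 𝒴 : ℕ → Set} {V : Set} (ρ : ∀ {k} → 𝒳 k → 𝒴 k) where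

    rename₂  : Term 𝒳 V → Term 𝒴 V
    rename₂* : ∀ {k} → Vec (Term 𝒳 V) k → Vec (Term 𝒴 V) k
    rename₂ (var x)     = var x
    rename₂ (fn f ts)   = fn f (rename₂* ts)
    rename₂ (meta X ts) = meta (ρ X) (rename₂* ts)
    rename₂* []       = []
    rename₂* (t ∷ ts) = rename₂ t ∷ rename₂* ts

  -- 2nd-order substitution; σ X is the body of the closed λ-abstraction
  -- substituted for X, so that X(x⃗) is mapped to σ X.
  module _ {𝒳 𝒴 : ℕ → Set} {V : Set} (σ : ∀ {k} → 𝒳 k → Term 𝒴 (Fin k)) where

    subst₂  : Term 𝒳 V → Term 𝒴 V
    subst₂* : ∀ {k} → Vec (Term 𝒳 V) k → Vec (Term 𝒴 V) k
    subst₂ (var x)     = var x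
    subst₂ (fn f ts)   = fn f (subst₂* ts)
    subst₂ (meta X ts) = bind (lookup (subst₂* ts)) (σ X)
    subst₂* []       = []
    subst₂* (t ∷ ts) = subst₂ t ∷ subst₂* ts

  -- let X₁,…,Xₙ = b₁,…,bₙ in M, where B k is the set of things to which 2nd-order
  -- variables of arity k may be bound. The last field states both that M is
  -- linear and that it is canonical in the Xᵢ. There being no bound names,
  -- expressions equal up to renaming of bound variables are identical.
  record LetExpr (B : ℕ → Set) : Set where
    constructor letExpr
    field
      arities   : List ℕ
      bindings  : All B arities
      body      : Term (_∈ arities) ℕ
      canonical : metas body ≡ allMetas arities

  open LetExpr public

  mapBindings : ∀ {B C : ℕ → Set} → (∀ {k} → B k → C k) → LetExpr B → LetExpr C
  mapBindings f (letExpr Γ bs M c) = letExpr Γ (All.map f bs) M c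

  Closed : ℕ → Set
  Closed k = FO (Fin k)

  ⟦_⟧ : LetExpr Closed → FO ℕ
  ⟦ ς ⟧ = subst₂ (All.lookup (bindings ς)) (body ς)

  -- Substitution in let-expressions. Since the body is linear, no information is
  -- lost by using the binding of a 2nd-order variable as its name, which gives a
  -- term over B. Such terms are substituted as usual, duplicating bindings along
  -- with bodies, and then `canonicalise` chooses fresh 2nd-order variables for
  -- the occurrences, in pre-order.
  inline : ∀ {B} → LetExpr B → Term B ℕ
  inline ς = rename₂ (All.lookup (bindings ς)) (body ς)

  module _ {B : ℕ → Set} {V : Set} where

    aritiesOf  : Term B V → List ℕ
    aritiesOf* : ∀ {k} → Vec (Term B V) k → List ℕ
    aritiesOf (var x)         = []
    aritiesOf (fn f ts)       = aritiesOf* ts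
    aritiesOf (meta {k} b ts) = k ∷ aritiesOf* ts
    aritiesOf* []       = []
    aritiesOf* (t ∷ ts) = aritiesOf t ++ aritiesOf* ts

    bindingsOf  : (t : Term B V) → All B (aritiesOf t)
    bindingsOf* : ∀ {k} (ts : Vec (Term B V) k) → All B (aritiesOf* ts)
    bindingsOf (var x)     = []
    bindingsOf (fn f ts)   = bindingsOf* ts
    bindingsOf (meta b ts) = b ∷ bindingsOf* ts
    bindingsOf* []       = []
    bindingsOf* (t ∷ ts) = All.++⁺ (bindingsOf t) (bindingsOf* ts)

    bodyOf  : (t : Term B V) → Term (_∈ aritiesOf t) V
    bodyOf* : ∀ {k} (ts : Vec (Term B V) k) → Vec (Term (_∈ aritiesOf* ts) V) k
    bodyOf (var x)     = var x
    bodyOf (fn f ts)   = fn f (bodyOf* ts)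
    bodyOf (meta b ts) = meta (here refl) (rename₂* there (bodyOf* ts))
    bodyOf* []       = []
    bodyOf* (t ∷ ts) =
      rename₂ ∈-++⁺ˡ (bodyOf t) ∷ rename₂* (∈-++⁺ʳ (aritiesOf t)) (bodyOf* ts)

  under : ∀ {𝒳 𝒴 : ℕ → Set} → (∀ {k} → 𝒳 k → 𝒴 k) → ∃ 𝒳 → ∃ 𝒴
  under ρ (k , X) = k , ρ X

  module _ {𝒳 𝒴 : ℕ → Set} {V : Set} (ρ : ∀ {k} → 𝒳 k → 𝒴 k) where

    metas-rename₂  : (t : Term 𝒳 V) →
                     metas (rename₂ ρ t) ≡ map (under ρ) (metas t)
    metas-rename₂* : ∀ {k} (ts : Vec (Term 𝒳 V) k) →
                     metas* (rename₂* ρ ts) ≡ map (under ρ) (metas* ts)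
    metas-rename₂ (var x)     = refl
    metas-rename₂ (fn f ts)   = metas-rename₂* ts
    metas-rename₂ (meta X ts) = cong (_ ∷_) (metas-rename₂* ts)
    metas-rename₂* []       = refl
    metas-rename₂* (t ∷ ts) =
      trans (cong₂ _++_ (metas-rename₂ t) (metas-rename₂* ts))
            (sym (map-++ (under ρ) (metas t) (metas* ts)))

  allMetas-∷ : ∀ k Γ →
               allMetas (k ∷ Γ) ≡ (k , here refl) ∷ map (under there) (allMetas Γ)
  allMetas-∷ k Γ = cong (_ ∷_) (sym (map-mapWith∈ Γ _ (under there)))

  allMetas-++ : ∀ Γ Δ →
                allMetas (Γ ++ Δ) ≡
                map (under ∈-++⁺ˡ) (allMetas Γ) ++ map (under (∈-++⁺ʳ Γ)) (allMetas Δ)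
  allMetas-++ []      Δ = sym (map-mapWith∈ Δ _ (under id))
  allMetas-++ (k ∷ Γ) Δ = begin
    allMetas (k ∷ Γ ++ Δ)
      ≡⟨ allMetas-∷ k (Γ ++ Δ) ⟩
    (k , here refl) ∷ map (under there) (allMetas (Γ ++ Δ))
      ≡⟨ cong (λ Xs → _ ∷ map (under there) Xs) (allMetas-++ Γ Δ) ⟩
    (k , here refl) ∷ map (under there)
      (map (under ∈-++⁺ˡ) (allMetas Γ) ++ map (under (∈-++⁺ʳ Γ)) (allMetas Δ))
      ≡⟨ cong (_ ∷_) (map-++ (under there) (map (under ∈-++⁺ˡ) (allMetas Γ)) _) ⟩
    (k , here refl) ∷
      map (under there) (map (under ∈-++⁺ˡ) (allMetas Γ)) ++
      map (under there) (map (under (∈-++⁺ʳ Γ)) (allMetas Δ))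
      ≡⟨ cong (_ ∷_) (cong₂ _++_
           (trans (sym (map-∘ (allMetas Γ))) (map-∘ (allMetas Γ)))
           (sym (map-∘ (allMetas Δ)))) ⟩
    (k , here refl) ∷
      map (under ∈-++⁺ˡ) (map (under there) (allMetas Γ)) ++
      map (under (∈-++⁺ʳ (k ∷ Γ))) (allMetas Δ)
      ≡⟨ cong (λ Xs → map (under ∈-++⁺ˡ) Xs ++ map (under (∈-++⁺ʳ (k ∷ Γ))) (allMetas Δ))
           (sym (allMetas-∷ k Γ)) ⟩
    map (under ∈-++⁺ˡ) (allMetas (k ∷ Γ)) ++ map (under (∈-++⁺ʳ (k ∷ Γ))) (allMetas Δ)
      ∎
    where open ≡-Reasoning

  module _ {B : ℕ → Set} {V : Set} where

    metas-bodyOf  : (t : Term B V) → metas (bodyOf t) ≡ allMetas (aritiesOf t)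
    metas-bodyOf* : ∀ {k} (ts : Vec (Term B V) k) →
                    metas* (bodyOf* ts) ≡ allMetas (aritiesOf* ts)
    metas-bodyOf (var x)         = refl
    metas-bodyOf (fn f ts)       = metas-bodyOf* ts
    metas-bodyOf (meta {k} b ts) = begin
      (k , here refl) ∷ metas* (rename₂* there (bodyOf* ts))
        ≡⟨ cong ((k , here refl) ∷_) (metas-rename₂* there (bodyOf* ts)) ⟩
      (k , here refl) ∷ map (under there) (metas* (bodyOf* ts))
        ≡⟨ cong (λ Xs → (k , here refl) ∷ map (under there) Xs) (metas-bodyOf* ts) ⟩
      (k , here refl) ∷ map (under there) (allMetas (aritiesOf* ts))
        ≡⟨ sym (allMetas-∷ k (aritiesOf* ts)) ⟩
      allMetas (k ∷ aritiesOf* ts)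
        ∎
      where open ≡-Reasoning
    metas-bodyOf* []       = refl
    metas-bodyOf* (t ∷ ts) =
      trans (cong₂ _++_
              (trans (metas-rename₂ ∈-++⁺ˡ (bodyOf t))
                     (cong (map (under ∈-++⁺ˡ)) (metas-bodyOf t)))
              (trans (metas-rename₂* (∈-++⁺ʳ (aritiesOf t)) (bodyOf* ts))
                     (cong (map (under (∈-++⁺ʳ (aritiesOf t)))) (metas-bodyOf* ts))))
            (sym (allMetas-++ (aritiesOf t) (aritiesOf* ts)))

  canonicalise : ∀ {B} → Term B ℕ → LetExpr B
  canonicalise t = letExpr (aritiesOf t) (bindingsOf t) (bodyOf t) (metas-bodyOf t)

  _[_≔ₗ_] : ∀ {B n} → LetExpr B → Vec ℕ n → Vec (LetExpr B) n → LetExpr B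
  Φ [ xs ≔ₗ Φs ] = canonicalise (inline Φ [ xs ≔ₜ Vec.map inline Φs ])

  -- λ x₁…x_k.s for a non-variable 1st-order s, linear and canonical.
  record Pattern (k : ℕ) : Set where
    constructor pattern′
    field
      term      : FO (Fin k)
      nonVar    : NonVar term
      canonical : vars term ≡ allFin k

  Multipattern : Set
  Multipattern = LetExpr Pattern

  ⟦_⟧ₚ : Multipattern → FO ℕ
  ⟦ ς ⟧ₚ = ⟦ mapBindings Pattern.term ς ⟧

  patternSize bodySize : Multipattern → Size
  patternSize ς = Σₛ (All.reduce (size Fin._≟_ ∘ Pattern.term) (bindings ς))
  bodySize ς    = size ℕ._≟_ (body ς)

  _⊑_ : Multipattern → Multipattern → Set
  ς ⊑ ζ =
    Σ[ σ ∈ (∀ {k} → k ∈ arities ζ → Term (_∈ arities ς) (Fin k)) ]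
      subst₂ σ (body ζ) ≡ body ς ×
      (∀ {k} (Y : k ∈ arities ζ) →
        subst₂ (Pattern.term ∘ All.lookup (bindings ς)) (σ Y) ≡
        Pattern.term (All.lookup (bindings ζ) Y))

  MultipatternOf : FO ℕ → Set
  MultipatternOf t = Σ[ ς ∈ Multipattern ] ⟦ ς ⟧ₚ ≡ t

  -- The lattice operations on the multipatterns denoting t are given by their
  -- order-theoretic characterisation.
  module _ {t : FO ℕ} where

    infix 4 _≼_ _⋒_≐_ _⋓_≐_

    _≼_ : MultipatternOf t → MultipatternOf t → Set
    (ς , _) ≼ (ζ , _) = ς ⊑ ζ

    IsBottom IsTop : MultipatternOf t → Set
    IsBottom = Minimum _≼_
    IsTop    = Maximum _≼_

    IsMeet IsJoin : (ς ζ ξ : MultipatternOf t) → Set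
    IsMeet ς ζ ξ = ξ ≼ ς × ξ ≼ ζ × (∀ χ → χ ≼ ς → χ ≼ ζ → χ ≼ ξ)
    IsJoin ς ζ ξ = ς ≼ ξ × ζ ≼ ξ × (∀ χ → ς ≼ χ → ζ ≼ χ → ξ ≼ χ)

    -- ς ⋒ ζ ≐ p and ς ⋓ ζ ≐ p: the amount of (non-)overlap of ς and ζ is p.
    _⋒_≐_ _⋓_≐_ : (ς ζ : MultipatternOf t) → Size → Set
    ς ⋒ ζ ≐ p = ∃[ ξ ] IsMeet ς ζ ξ × patternSize (proj₁ ξ) ≡ p
    ς ⋓ ζ ≐ p = ∃[ ξ ] IsJoin ς ζ ξ × bodySize (proj₁ ξ) ≡ p

    Overlapping CriticallyOverlapping : (ς ζ : MultipatternOf t) → Set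
    Overlapping ς ζ = ∃[ ξ ] IsMeet ς ζ ξ × ¬ IsBottom ξ
    CriticallyOverlapping ς ζ =
      Overlapping ς ζ × (∃[ ξ ] IsJoin ς ζ ξ × IsTop ξ) × Linear t

  -- Rule k is the set of rule symbols ϱ(x₁,…,x_k) : ℓ → r. That the variables of r
  -- occur in ℓ follows from `ordered`, as r is a term over x₁,…,x_k.
  record TRS : Set₁ where
    field
      Rule    : ℕ → Set
      lhs rhs : ∀ {k} → Rule k → FO (Fin k)
      nonVar  : ∀ {k} (ϱ : Rule k) → NonVar (lhs ϱ)
      ordered : ∀ {k} (ϱ : Rule k) → deduplicate Fin._≟_ (vars (lhs ϱ)) ≡ allFin k

  LeftLinear : TRS → Set
  LeftLinear R = ∀ {k} (ϱ : Rule k) → Linear (lhs ϱ)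
    where open TRS R

  -- A binding ϱ : Rule k stands for λ x₁…x_k.ϱ(x₁,…,x_k).
  Multistep : TRS → Set
  Multistep R = LetExpr (TRS.Rule R)

  deduplicate-Unique : ∀ {k} {is : List (Fin k)} → Unique is →
                       deduplicate Fin._≟_ is ≡ is
  deduplicate-Unique []                      = refl
  deduplicate-Unique {is = i ∷ is} (i∉ ∷ is!) = cong (i ∷_)
    (trans (cong (filter (¬? ∘ (i Fin.≟_))) (deduplicate-Unique is!))
           (filter-all (¬? ∘ (i Fin.≟_)) i∉))

  module Steps (R : TRS) (leftLinear : LeftLinear R) where
    open TRS R

    infix 4 _∶_⊸_ _⋒≥_ _⋓>_

    lhsPattern : ∀ {k} → Rule k → Pattern k
    lhsPattern ϱ = pattern′ (lhs ϱ) (nonVar ϱ)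
      (trans (sym (deduplicate-Unique (leftLinear ϱ))) (ordered ϱ))

    src : Multistep R → Multipattern
    src = mapBindings lhsPattern

    tgt : Multistep R → LetExpr Closed
    tgt = mapBindings rhs

    _∶_⊸_ : Multistep R → FO ℕ → FO ℕ → Set
    Φ ∶ t ⊸ s = ⟦ src Φ ⟧ₚ ≡ t × ⟦ tgt Φ ⟧ ≡ s

    record Peak : Set where
      constructor peak
      field
        {s t u} : FO ℕ
        Φ Ψ     : Multistep R
        Φ∶t⊸s   : Φ ∶ t ⊸ s
        Ψ∶t⊸u   : Ψ ∶ t ⊸ u

      srcΦ srcΨ : MultipatternOf t
      srcΦ = src Φ , proj₁ Φ∶t⊸s
      srcΨ = src Ψ , proj₁ Ψ∶t⊸u

    OverlappingPeak CriticalPeak : Peak → Set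
    OverlappingPeak P = Overlapping (Peak.srcΦ P) (Peak.srcΨ P)
    CriticalPeak P    = CriticallyOverlapping (Peak.srcΦ P) (Peak.srcΨ P)

    -- Φ ⋒ Ψ ≥ Φ′ ⋒ Ψ′ and Φ ⋓ Ψ > Φ′ ⋓ Ψ′ for peaks P = (Φ , Ψ), P′ = (Φ′ , Ψ′).
    _⋒≥_ _⋓>_ : Peak → Peak → Set
    P ⋒≥ P′ = ∃₂ λ p p′ →
      Peak.srcΦ P  ⋒ Peak.srcΨ P  ≐ p ×
      Peak.srcΦ P′ ⋒ Peak.srcΨ P′ ≐ p′ × p ≥ₛ p′
    P ⋓> P′ = ∃₂ λ p p′ →
      Peak.srcΦ P  ⋓ Peak.srcΨ P  ≐ p ×
      Peak.srcΦ P′ ⋓ Peak.srcΨ P′ ≐ p′ × p >ₛ p′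

{-# OPTIONS --safe #-}
module Submission where

-- A multipattern denoting t amounts to a subgraph of the tree t: the symbols covered by
-- the patterns, together with the edges inside the patterns. Under this correspondence ⊑
-- is inclusion, and ⊓ and ⊔ are intersection and union. Write the body of the join of a
-- peak Φ, Ψ as h(N₁,…,N_k), where h is a function symbol or a 2nd-order variable. Edges
-- inside patterns of Φ or Ψ are inside patterns of the join, so that Φ and Ψ can both be
-- cut where the Nᵢ start, giving Φ₀, Ψ₀ with join h(x₁,…,x_k), and Φᵢ, Ψᵢ with join Nᵢ.
-- This decreases the body-size of the join unless all Nᵢ are variables. In that case, if
-- h is a function symbol, then there is no overlap, and otherwise the join is the top, so
-- that the peak is critical unless Nᵢ = Nⱼ for some i ≠ j, in which case the body-size
-- decreases in its second component.

open import Defs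
open import Data.Fin.Base using (Fin; zero; suc; toℕ; _↑ˡ_; _↑ʳ_)
import Data.Fin.Properties as Fin
open import Data.List.Base as List using (List; []; _∷_; _++_; concatMap; allFin)
import Data.List.Membership.DecPropositional as DecPropositional
open import Data.List.Membership.Propositional using (_∈_)
open import Data.List.Membership.Propositional.Properties
  using (∈-++⁺ˡ; ∈-++⁺ʳ; ∈-++⁻; ∈-map⁺; ∈-map⁻; ∈-allFin; ∈-deduplicate⁺; map-mapWith∈; mapWith∈-id)
import Data.List.Properties as List
open import Data.List.Relation.Unary.All as All using (All; []; _∷_)
import Data.List.Relation.Unary.All.Properties as All
import Data.List.Relation.Unary.AllPairs as AllPairs
open import Data.List.Relation.Binary.Sublist.Propositional
  using (_⊆_; []; _∷_; _∷ʳ_; ⊆-refl; minimum)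
import Data.List.Relation.Binary.Sublist.Propositional.Properties as Sublist
open import Data.List.Relation.Unary.Any using (here; there)
import Data.List.Relation.Unary.Unique.Propositional as ListUnique
open import Data.List.Relation.Unary.Unique.DecPropositional.Properties using (deduplicate-!)
open import Data.List.Relation.Unary.Unique.Propositional.Properties
  using (allFin⁺; map⁺)
open import Data.Nat.Base as ℕ using (ℕ; zero; suc; _+_; _*_; _^_; _≤_; _<_; s≤s; z≤n)
open import Data.Nat.ListAction using (sum)
import Data.Nat.Properties as ℕ
open import Data.Product.Base as Product
  using (∃; Σ-syntax; ∃-syntax; _×_; _,_; proj₁; proj₂)
open import Data.Sum.Base using (_⊎_; inj₁; inj₂)
open import Data.Vec.Base as Vec using (Vec; []; _∷_; map; lookup)
import Data.Vec.Properties as Vec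
import Data.Vec.Relation.Unary.All.Properties as VecAll
import Data.Vec.Relation.Unary.AllPairs as VecAllPairs
open import Data.Vec.Relation.Unary.Unique.Propositional using (Unique)
import Data.Vec.Relation.Unary.Unique.Propositional.Properties as VecUnique
open import Function.Base using (_∘_; id; case_of_)
open import Relation.Binary.Construct.Closure.Reflexive using (refl; [_])
open import Relation.Binary.Definitions using (DecidableEquality)
open import Relation.Binary.PropositionalEquality
  using (_≡_; _≗_; refl; sym; trans; cong; cong₂; subst; module ≡-Reasoning)
open import Axiom.UniquenessOfIdentityProofs.WithK using (uip)
open import Relation.Nullary.Decidable using (yes; no; dec-true; dec-false)
open import Relation.Nullary.Negation.Core using (¬_; contradiction)

-- Meets and joins are characterised only by their universal properties, so they have to be
-- constructed. Decorating the symbols of t turns them into pointwise minima and maxima, which exist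
-- because valid decorations are closed under both and each valid decoration comes from a
-- multipattern. Pointwise operations also commute with plugging terms into holes, so that the meet
-- and the join of a peak split along the same cut as the peak itself. The cut exists because the Nᵢ
-- are themselves bodies: their roots may start a pattern but cannot continue one, so no pattern of
-- Φ or Ψ reaches across a hole. The overlap does not grow, since the patterns in the meets of the
-- pieces are among those in the meet of the peak. The second component of sizes measures repetition
-- of variables: for k occurrences the sum of squares is at least k, with equality just for linear
-- terms. Linearity has a further use: data found at each occurrence of a variable form a function
-- of the variable if it occurs exactly once. This yields the pieces Φᵢ, Ψᵢ as well as the 2nd-order
-- substitution witnessing ⊑.

-- Lists: enumerations without repetition, and multiplicities.

module _ {A : Set} {P : A → Set} where

  -- A list enumerating the index set without repetition is a dependent function.
  choose : ∀ {xs} (ps : List (∃ P)) → List.map proj₁ ps ≡ xs → ∀ {x} → x ∈ xs → P x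
  choose ps refl x∈ with ∈-map⁻ proj₁ x∈
  ... | (_ , p) , _ , refl = p

  -- Absence of repetition leaves only one entry over each index, so replacing the witness of an
  -- entry by the chosen one changes nothing.
  choose-unique : ∀ {xs} (ps : List (∃ P)) (eq : List.map proj₁ ps ≡ xs) →
                  ListUnique.Unique xs → ∀ {q} → q ∈ ps → (x∈ : proj₁ q ∈ xs) →
                  q ≡ (proj₁ q , choose ps eq x∈)
  choose-unique ps refl xs! q∈ x∈ with ∈-map⁻ proj₁ x∈
  ... | (_ , p) , p∈ , refl = same ps xs! q∈ p∈
    where
    same : ∀ ps → ListUnique.Unique (List.map proj₁ ps) →
           ∀ {x} {p q : P x} → (x , q) ∈ ps → (x , p) ∈ ps → (x , q) ≡ (x , p)
    same (_ ∷ _)  _                   (here refl) (here refl) = refl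
    same (_ ∷ ps) (x∉ AllPairs.∷ _)   (here refl) (there p∈)  =
      contradiction refl (All.lookup x∉ (∈-map⁺ proj₁ p∈))
    same (_ ∷ ps) (x∉ AllPairs.∷ _)   (there q∈)  (here refl) =
      contradiction refl (All.lookup x∉ (∈-map⁺ proj₁ q∈))
    same (_ ∷ ps) (_ AllPairs.∷ xs!)  (there q∈)  (there p∈)  = same ps xs! q∈ p∈

allFin-+ : ∀ m n → List.map (_↑ˡ n) (allFin m) ++ List.map (m ↑ʳ_) (allFin n) ≡ allFin (m + n)
allFin-+ m n = trans (cong₂ _++_ (List.map-tabulate id (_↑ˡ n)) (List.map-tabulate id (m ↑ʳ_)))
                     (tabulate-++ m id)
  where
  tabulate-++ : ∀ m {n} {A : Set} (f : Fin (m + n) → A) →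
                List.tabulate (f ∘ (_↑ˡ n)) ++ List.tabulate (f ∘ (m ↑ʳ_)) ≡ List.tabulate f
  tabulate-++ zero    f = refl
  tabulate-++ (suc m) f = cong (_ ∷_) (tabulate-++ m (f ∘ suc))

-- A canonical pattern visits its arguments once each and in order. This is why plugging them in
-- preserves the list of variable occurrences, as `vars-mark` needs.
concatMap-lookup-allFin : ∀ {A B : Set} {k} (f : A → List B) (xs : Vec A k) →
                          concatMap (f ∘ lookup xs) (allFin k) ≡ List.concat (Vec.toList (map f xs))
concatMap-lookup-allFin f []       = refl
concatMap-lookup-allFin {k = suc k} f (x ∷ xs) = cong (f x ++_)
  (trans (cong List.concat (trans (List.map-tabulate suc (f ∘ lookup (x ∷ xs)))
                                  (sym (List.map-tabulate id (f ∘ lookup xs)))))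
         (concatMap-lookup-allFin f xs))

module _ {A : Set} where

  module _ {f g : A → ℕ} (f≤g : ∀ x → f x ≤ g x) where

    sum-map-mono : ∀ xs → sum (List.map f xs) ≤ sum (List.map g xs)
    sum-map-mono []       = z≤n
    sum-map-mono (x ∷ xs) = ℕ.+-mono-≤ (f≤g x) (sum-map-mono xs)

    sum-map-mono-< : ∀ {x xs} → x ∈ xs → f x < g x → sum (List.map f xs) < sum (List.map g xs)
    sum-map-mono-< {xs = _ ∷ xs} (here refl) fx<gx = ℕ.+-mono-<-≤ fx<gx (sum-map-mono xs)
    sum-map-mono-< {xs = y ∷ _}  (there x∈)  fx<gx = ℕ.+-mono-≤-< (f≤g y) (sum-map-mono-< x∈ fx<gx)

module Counting {A : Set} (_≟_ : DecidableEquality A) where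
  open DecPropositional _≟_ using (_∈?_)

  count : A → List A → ℕ
  count x = List.length ∘ List.filter (x ≟_)

  -- The second component of `size`, as a function of the list of occurrences.
  squares : List A → ℕ
  squares xs = sum (List.map (λ x → count x xs ^ 2) (List.deduplicate _≟_ xs))

  count-here : ∀ x xs → count x (x ∷ xs) ≡ suc (count x xs)
  count-here x xs = cong List.length (List.filter-accept (x ≟_) refl)

  count-there : ∀ {x y} → ¬ x ≡ y → ∀ xs → count x (y ∷ xs) ≡ count x xs
  count-there x≢y xs = cong List.length (List.filter-reject (_ ≟_) x≢y)

  count-∷ : ∀ x y xs → count x xs ≤ count x (y ∷ xs)
  count-∷ x y xs = case x ≟ y of λ where
    (yes refl) → ℕ.≤-trans (ℕ.n≤1+n _) (ℕ.≤-reflexive (sym (count-here x xs)))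
    (no  x≢y)  → ℕ.≤-reflexive (sym (count-there x≢y xs))

  sum-count-∷ : ∀ {x ys} → ListUnique.Unique ys → x ∈ ys → ∀ xs →
                sum (List.map (λ y → count y (x ∷ xs)) ys) ≡
                suc (sum (List.map (λ y → count y xs) ys))
  sum-count-∷ {x} {_ ∷ ys} (x∉ AllPairs.∷ _)   (here refl) xs = cong₂ _+_ (count-here x xs)
    (cong sum (List.map-cong-local (All.map (λ x≢y → count-there (x≢y ∘ sym) xs) x∉)))
  sum-count-∷ {ys = y ∷ ys} (y∉ AllPairs.∷ ys!) (there x∈)  xs = trans
    (cong₂ _+_ (count-there (All.lookup y∉ x∈) xs) (sum-count-∷ ys! x∈ xs))
    (ℕ.+-suc (count y xs) _)

  sum-count : ∀ {ys} → ListUnique.Unique ys → ∀ xs → (∀ {x} → x ∈ xs → x ∈ ys) →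
              sum (List.map (λ y → count y xs) ys) ≡ List.length xs
  sum-count {ys} ys! []       _     = zeros ys
    where
    zeros : ∀ ys → sum (List.map (λ _ → 0) ys) ≡ 0
    zeros []       = refl
    zeros (_ ∷ ys) = zeros ys
  sum-count ys! (x ∷ xs) xs⊆ys =
    trans (sum-count-∷ ys! (xs⊆ys (here refl)) xs) (cong suc (sum-count ys! xs (xs⊆ys ∘ there)))

  unique⊎duplicate : ∀ xs → ListUnique.Unique xs ⊎ ∃[ x ] x ∈ xs × 1 < count x xs
  unique⊎duplicate []       = inj₁ AllPairs.[]
  unique⊎duplicate (x ∷ xs) with x ∈? xs
  ... | yes x∈ = inj₂ (x , here refl , ℕ.≤-trans (s≤s (List.filter-some (x ≟_) x∈))
                                                (ℕ.≤-reflexive (sym (count-here x xs))))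
  ... | no x∉ with unique⊎duplicate xs
  ...   | inj₁ xs! = inj₁ (All.¬Any⇒All¬ xs x∉ AllPairs.∷ xs!)
  ...   | inj₂ (y , y∈ , 1<) = inj₂ (y , there y∈ , ℕ.≤-trans 1< (count-∷ y x xs))

  unique⇒count≤1 : ∀ {xs} → ListUnique.Unique xs → ∀ x → count x xs ≤ 1
  unique⇒count≤1 AllPairs.[] x = z≤n
  unique⇒count≤1 {y ∷ xs} (y∉ AllPairs.∷ xs!) x = case x ≟ y of λ where
    (yes refl) → ℕ.≤-reflexive (trans (count-here x xs)
                   (cong (suc ∘ List.length) (List.filter-none (x ≟_) y∉)))
    (no x≢y)   → ℕ.≤-trans (ℕ.≤-reflexive (count-there x≢y xs)) (unique⇒count≤1 xs! x)

  sum-count-deduplicate : ∀ xs → sum (List.map (λ x → count x xs) (List.deduplicate _≟_ xs)) ≡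
                                 List.length xs
  sum-count-deduplicate xs = sum-count (deduplicate-! _≟_ xs) xs (∈-deduplicate⁺ _≟_)

  squares-unique : ∀ {xs} → ListUnique.Unique xs → squares xs ≤ List.length xs
  squares-unique {xs} xs! = ℕ.≤-trans
    (sum-map-mono (λ x → n^2≤n (unique⇒count≤1 xs! x)) (List.deduplicate _≟_ xs))
    (ℕ.≤-reflexive (sum-count-deduplicate xs))
    where
    n^2≤n : ∀ {n} → n ≤ 1 → n ^ 2 ≤ n
    n^2≤n z≤n       = z≤n
    n^2≤n (s≤s z≤n) = s≤s z≤n

  -- The length is the sum of the multiplicities n, and n ≤ n², strictly for n > 1. Together with
  -- `squares-unique`, the length thus separates the sums of squares of linear lists from those of
  -- non-linear ones.
  squares-duplicate : ∀ {x xs} → x ∈ xs → 1 < count x xs → List.length xs < squares xs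
  squares-duplicate {x} {xs} x∈ 1< =
    subst (_< squares xs) (sum-count-deduplicate xs)
      (sum-map-mono-< (λ y → n≤n^2 (count y xs)) (∈-deduplicate⁺ _≟_ x∈)
                      (subst (_< count x xs ^ 2) (ℕ.*-identityʳ _)
                        (ℕ.^-monoʳ-< (count x xs) 1< {1} {2} (s≤s (s≤s z≤n)))))
    where
    n≤n^2 : ∀ n → n ≤ n ^ 2
    n≤n^2 zero    = z≤n
    n≤n^2 (suc n) = ℕ.m≤m*n (suc n) (suc n * 1)

-- Laws of 1st-order and 2nd-order substitution, and linearity.

module TermLemmas (Sym : ℕ → Set) where
  open Rewriting Sym

  private variable
    𝒳 𝒴 𝒵 : ℕ → Set
    U V W : Set
    k : ℕ

  fn-injective : ∀ {k l} {f : Sym k} {g : Sym l} {ts : Vec (Term 𝒳 V) k} {us} →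
                 Term.fn f ts ≡ fn g us →
                 Σ[ eq ∈ k ≡ l ] subst Sym eq f ≡ g × subst (Vec _) eq ts ≡ us
  fn-injective refl = refl , refl , refl

  meta-injective : ∀ {k l} {X : 𝒳 k} {Y : 𝒳 l} {ts : Vec (Term 𝒳 V) k} {us} →
                   Term.meta X ts ≡ meta Y us →
                   Σ[ eq ∈ k ≡ l ] subst 𝒳 eq X ≡ Y × subst (Vec _) eq ts ≡ us
  meta-injective refl = refl , refl , refl

  bind*-map : (σ : V → Term 𝒳 W) (ts : Vec (Term 𝒳 V) k) → bind* σ ts ≡ map (bind σ) ts
  bind*-map σ []       = refl
  bind*-map σ (t ∷ ts) = cong (_ ∷_) (bind*-map σ ts)

  rename₂*-map : (ρ : ∀ {k} → 𝒳 k → 𝒴 k) (ts : Vec (Term 𝒳 V) k) →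
                 rename₂* ρ ts ≡ map (rename₂ ρ) ts
  rename₂*-map ρ []       = refl
  rename₂*-map ρ (t ∷ ts) = cong (_ ∷_) (rename₂*-map ρ ts)

  subst₂*-map : (σ : ∀ {k} → 𝒳 k → Term 𝒴 (Fin k)) (ts : Vec (Term 𝒳 V) k) →
                subst₂* σ ts ≡ map (subst₂ σ) ts
  subst₂*-map σ []       = refl
  subst₂*-map σ (t ∷ ts) = cong (_ ∷_) (subst₂*-map σ ts)

  vars*-map : (ts : Vec (Term 𝒳 V) k) → vars* ts ≡ List.concat (Vec.toList (map vars ts))
  vars*-map []       = refl
  vars*-map (t ∷ ts) = cong (vars t ++_) (vars*-map ts)

  lookup-bind* : (σ : V → Term 𝒳 W) (ts : Vec (Term 𝒳 V) k) →
                 lookup (bind* σ ts) ≗ bind σ ∘ lookup ts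
  lookup-bind* σ ts i = trans (cong (λ us → lookup us i) (bind*-map σ ts)) (Vec.lookup-map i _ ts)

  lookup-rename₂* : (ρ : ∀ {k} → 𝒳 k → 𝒴 k) (ts : Vec (Term 𝒳 V) k) →
                    lookup (rename₂* ρ ts) ≗ rename₂ ρ ∘ lookup ts
  lookup-rename₂* ρ ts i =
    trans (cong (λ us → lookup us i) (rename₂*-map ρ ts)) (Vec.lookup-map i _ ts)

  lookup-subst₂* : (σ : ∀ {k} → 𝒳 k → Term 𝒴 (Fin k)) (ts : Vec (Term 𝒳 V) k) →
                   lookup (subst₂* σ ts) ≗ subst₂ σ ∘ lookup ts
  lookup-subst₂* σ ts i =
    trans (cong (λ us → lookup us i) (subst₂*-map σ ts)) (Vec.lookup-map i _ ts)

  module _ {σ τ : V → Term 𝒳 W} where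
    bind-cong-local  : ∀ t → (∀ {x} → x ∈ vars t → σ x ≡ τ x) → bind σ t ≡ bind τ t
    bind*-cong-local : (ts : Vec _ k) → (∀ {x} → x ∈ vars* ts → σ x ≡ τ x) →
                       bind* σ ts ≡ bind* τ ts
    bind-cong-local (var x)     eq = eq (here refl)
    bind-cong-local (fn f ts)   eq = cong (fn f) (bind*-cong-local ts eq)
    bind-cong-local (meta X ts) eq = cong (meta X) (bind*-cong-local ts eq)
    bind*-cong-local []       eq = refl
    bind*-cong-local (t ∷ ts) eq =
      cong₂ _∷_ (bind-cong-local t (eq ∘ ∈-++⁺ˡ)) (bind*-cong-local ts (eq ∘ ∈-++⁺ʳ (vars t)))

    bind-cong : σ ≗ τ → bind σ ≗ bind τ
    bind-cong eq t = bind-cong-local t (λ {x} _ → eq x)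

  module _ (τ : V → Term 𝒳 W) (σ : U → Term 𝒳 V) where
    bind-bind  : ∀ t → bind τ (bind σ t) ≡ bind (bind τ ∘ σ) t
    bind*-bind* : (ts : Vec _ k) → bind* τ (bind* σ ts) ≡ bind* (bind τ ∘ σ) ts
    bind-bind (var x)     = refl
    bind-bind (fn f ts)   = cong (fn f) (bind*-bind* ts)
    bind-bind (meta X ts) = cong (meta X) (bind*-bind* ts)
    bind*-bind* []       = refl
    bind*-bind* (t ∷ ts) = cong₂ _∷_ (bind-bind t) (bind*-bind* ts)

  bind-var  : (t : Term 𝒳 V) → bind var t ≡ t
  bind*-var : (ts : Vec (Term 𝒳 V) k) → bind* var ts ≡ ts
  bind-var (var x)     = refl
  bind-var (fn f ts)   = cong (fn f) (bind*-var ts)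
  bind-var (meta X ts) = cong (meta X) (bind*-var ts)
  bind*-var []       = refl
  bind*-var (t ∷ ts) = cong₂ _∷_ (bind-var t) (bind*-var ts)

  bind*-tabulate-var : (ts : Vec (Term 𝒳 V) k) → bind* (lookup ts) (Vec.tabulate var) ≡ ts
  bind*-tabulate-var ts = begin
    bind* (lookup ts) (Vec.tabulate var)       ≡⟨ bind*-map (lookup ts) _ ⟩
    map (bind (lookup ts)) (Vec.tabulate var)  ≡⟨ Vec.tabulate-∘ (bind (lookup ts)) var ⟨
    Vec.tabulate (lookup ts)                   ≡⟨ Vec.tabulate∘lookup ts ⟩
    ts                                         ∎
    where open ≡-Reasoning

  vars*-tabulate-var : ∀ k → vars* {𝒳} {Fin k} (Vec.tabulate var) ≡ allFin k
  vars*-tabulate-var k = go k id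
    where
    go : ∀ {V} k (f : Fin k → V) → vars* {𝒳} (Vec.tabulate (var ∘ f)) ≡ List.tabulate f
    go zero    f = refl
    go (suc k) f = cong (_ ∷_) (go k (f ∘ suc))

  module _ (σ : V → Term 𝒳 W) where
    vars-bind  : ∀ t → vars (bind σ t) ≡ concatMap (vars ∘ σ) (vars t)
    vars*-bind* : (ts : Vec _ k) → vars* (bind* σ ts) ≡ concatMap (vars ∘ σ) (vars* ts)
    vars-bind (var x)     = sym (List.++-identityʳ _)
    vars-bind (fn f ts)   = vars*-bind* ts
    vars-bind (meta X ts) = vars*-bind* ts
    vars*-bind* []       = refl
    vars*-bind* (t ∷ ts) = trans (cong₂ _++_ (vars-bind t) (vars*-bind* ts))
                                 (sym (List.concatMap-++ (vars ∘ σ) (vars t) _))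

  vars-bind-var : (f : V → W) (t : Term 𝒳 V) → vars (bind (var ∘ f) t) ≡ List.map f (vars t)
  vars-bind-var f t = trans (vars-bind (var ∘ f) t)
    (trans (cong List.concat (List.map-∘ (vars t))) (List.concat-map-[_] _))

  module _ (σ : ∀ {k} → 𝒳 k → Term 𝒴 (Fin k)) where
    -- What replaces a 2nd-order variable is closed, so `τ` can only act on its arguments.
    subst₂-bind   : (τ : V → Term 𝒳 W) → ∀ t →
                    subst₂ σ (bind τ t) ≡ bind (subst₂ σ ∘ τ) (subst₂ σ t)
    subst₂*-bind* : (τ : V → Term 𝒳 W) (ts : Vec _ k) →
                    subst₂* σ (bind* τ ts) ≡ bind* (subst₂ σ ∘ τ) (subst₂* σ ts)
    subst₂-bind τ (var x)     = refl
    subst₂-bind τ (fn f ts)   = cong (fn f) (subst₂*-bind* τ ts)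
    subst₂-bind τ (meta X ts) = trans
      (cong (λ us → bind (lookup us) (σ X)) (subst₂*-bind* τ ts))
      (trans (bind-cong (lookup-bind* _ (subst₂* σ ts)) (σ X)) (sym (bind-bind _ _ (σ X))))
    subst₂*-bind* τ []       = refl
    subst₂*-bind* τ (t ∷ ts) = cong₂ _∷_ (subst₂-bind τ t) (subst₂*-bind* τ ts)

    subst₂-rename₂   : (ρ : ∀ {k} → 𝒵 k → 𝒳 k) (t : Term 𝒵 V) →
                       subst₂ σ (rename₂ ρ t) ≡ subst₂ (σ ∘ ρ) t
    subst₂*-rename₂* : (ρ : ∀ {k} → 𝒵 k → 𝒳 k) (ts : Vec (Term 𝒵 V) k) →
                       subst₂* σ (rename₂* ρ ts) ≡ subst₂* (σ ∘ ρ) ts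
    subst₂-rename₂ ρ (var x)     = refl
    subst₂-rename₂ ρ (fn f ts)   = cong (fn f) (subst₂*-rename₂* ρ ts)
    subst₂-rename₂ ρ (meta X ts) =
      cong (λ us → bind (lookup us) (σ (ρ X))) (subst₂*-rename₂* ρ ts)
    subst₂*-rename₂* ρ []       = refl
    subst₂*-rename₂* ρ (t ∷ ts) = cong₂ _∷_ (subst₂-rename₂ ρ t) (subst₂*-rename₂* ρ ts)

  module _ {σ τ : ∀ {k} → 𝒳 k → Term 𝒴 (Fin k)} (eq : ∀ {k} (X : 𝒳 k) → σ X ≡ τ X) where
    subst₂-cong  : (t : Term 𝒳 V) → subst₂ σ t ≡ subst₂ τ t
    subst₂*-cong : (ts : Vec (Term 𝒳 V) k) → subst₂* σ ts ≡ subst₂* τ ts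
    subst₂-cong (var x)     = refl
    subst₂-cong (fn f ts)   = cong (fn f) (subst₂*-cong ts)
    subst₂-cong (meta X ts) = cong₂ (λ us → bind (lookup us)) (subst₂*-cong ts) (eq X)
    subst₂*-cong []       = refl
    subst₂*-cong (t ∷ ts) = cong₂ _∷_ (subst₂-cong t) (subst₂*-cong ts)

  module _ (ρ : ∀ {k} → 𝒳 k → 𝒴 k) where
    rename₂-bind   : (τ : V → Term 𝒳 W) → ∀ t →
                     rename₂ ρ (bind τ t) ≡ bind (rename₂ ρ ∘ τ) (rename₂ ρ t)
    rename₂*-bind* : (τ : V → Term 𝒳 W) (ts : Vec _ k) →
                     rename₂* ρ (bind* τ ts) ≡ bind* (rename₂ ρ ∘ τ) (rename₂* ρ ts)
    rename₂-bind τ (var x)     = refl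
    rename₂-bind τ (fn f ts)   = cong (fn f) (rename₂*-bind* τ ts)
    rename₂-bind τ (meta X ts) = cong (meta (ρ X)) (rename₂*-bind* τ ts)
    rename₂*-bind* τ []       = refl
    rename₂*-bind* τ (t ∷ ts) = cong₂ _∷_ (rename₂-bind τ t) (rename₂*-bind* τ ts)

    rename₂-subst₂   : (σ : ∀ {k} → 𝒵 k → Term 𝒳 (Fin k)) (t : Term 𝒵 V) →
                       rename₂ ρ (subst₂ σ t) ≡ subst₂ (rename₂ ρ ∘ σ) t
    rename₂*-subst₂* : (σ : ∀ {k} → 𝒵 k → Term 𝒳 (Fin k)) (ts : Vec (Term 𝒵 V) k) →
                       rename₂* ρ (subst₂* σ ts) ≡ subst₂* (rename₂ ρ ∘ σ) ts
    rename₂-subst₂ σ (var x)     = refl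
    rename₂-subst₂ σ (fn f ts)   = cong (fn f) (rename₂*-subst₂* σ ts)
    rename₂-subst₂ σ (meta X ts) = begin
      rename₂ ρ (bind (lookup (subst₂* σ ts)) (σ X))
        ≡⟨ rename₂-bind _ (σ X) ⟩
      bind (rename₂ ρ ∘ lookup (subst₂* σ ts)) (rename₂ ρ (σ X))
        ≡⟨ bind-cong (lookup-rename₂* ρ (subst₂* σ ts)) (rename₂ ρ (σ X)) ⟨
      bind (lookup (rename₂* ρ (subst₂* σ ts))) (rename₂ ρ (σ X))
        ≡⟨ cong (λ us → bind (lookup us) (rename₂ ρ (σ X))) (rename₂*-subst₂* σ ts) ⟩
      bind (lookup (subst₂* (rename₂ ρ ∘ σ) ts)) (rename₂ ρ (σ X)) ∎
      where open ≡-Reasoning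
    rename₂*-subst₂* σ []       = refl
    rename₂*-subst₂* σ (t ∷ ts) = cong₂ _∷_ (rename₂-subst₂ σ t) (rename₂*-subst₂* σ ts)

    rename₂-rename₂   : (π : ∀ {k} → 𝒵 k → 𝒳 k) (t : Term 𝒵 V) →
                        rename₂ ρ (rename₂ π t) ≡ rename₂ (ρ ∘ π) t
    rename₂*-rename₂* : (π : ∀ {k} → 𝒵 k → 𝒳 k) (ts : Vec (Term 𝒵 V) k) →
                        rename₂* ρ (rename₂* π ts) ≡ rename₂* (ρ ∘ π) ts
    rename₂-rename₂ π (var x)     = refl
    rename₂-rename₂ π (fn f ts)   = cong (fn f) (rename₂*-rename₂* π ts)
    rename₂-rename₂ π (meta X ts) = cong (meta _) (rename₂*-rename₂* π ts)
    rename₂*-rename₂* π []       = refl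
    rename₂*-rename₂* π (t ∷ ts) = cong₂ _∷_ (rename₂-rename₂ π t) (rename₂*-rename₂* π ts)

    vars-rename₂   : (t : Term 𝒳 V) → vars (rename₂ ρ t) ≡ vars t
    vars*-rename₂* : (ts : Vec (Term 𝒳 V) k) → vars* (rename₂* ρ ts) ≡ vars* ts
    vars-rename₂ (var x)     = refl
    vars-rename₂ (fn f ts)   = vars*-rename₂* ts
    vars-rename₂ (meta X ts) = vars*-rename₂* ts
    vars*-rename₂* []       = refl
    vars*-rename₂* (t ∷ ts) = cong₂ _++_ (vars-rename₂ t) (vars*-rename₂* ts)

    symbols-rename₂   : (t : Term 𝒳 V) → symbols (rename₂ ρ t) ≡ symbols t
    symbols*-rename₂* : (ts : Vec (Term 𝒳 V) k) → symbols* (rename₂* ρ ts) ≡ symbols* ts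
    symbols-rename₂ (var x)     = refl
    symbols-rename₂ (fn f ts)   = cong suc (symbols*-rename₂* ts)
    symbols-rename₂ (meta X ts) = cong suc (symbols*-rename₂* ts)
    symbols*-rename₂* []       = refl
    symbols*-rename₂* (t ∷ ts) = cong₂ _+_ (symbols-rename₂ t) (symbols*-rename₂* ts)

  module _ {ρ π : ∀ {k} → 𝒳 k → 𝒴 k} where
    rename₂-cong-local  : (t : Term 𝒳 V) → (∀ {k X} → (k , X) ∈ metas t → ρ X ≡ π X) →
                          rename₂ ρ t ≡ rename₂ π t
    rename₂*-cong-local : (ts : Vec (Term 𝒳 V) k) →
                          (∀ {k X} → (k , X) ∈ metas* ts → ρ X ≡ π X) →
                          rename₂* ρ ts ≡ rename₂* π ts
    rename₂-cong-local (var x)     eq = refl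
    rename₂-cong-local (fn f ts)   eq = cong (fn f) (rename₂*-cong-local ts eq)
    rename₂-cong-local (meta X ts) eq =
      cong₂ meta (eq (here refl)) (rename₂*-cong-local ts (eq ∘ there))
    rename₂*-cong-local []       eq = refl
    rename₂*-cong-local (t ∷ ts) eq =
      cong₂ _∷_ (rename₂-cong-local t (eq ∘ ∈-++⁺ˡ))
                (rename₂*-cong-local ts (eq ∘ ∈-++⁺ʳ (metas t)))

  rename₂-id  : (t : Term 𝒳 V) → rename₂ id t ≡ t
  rename₂*-id : (ts : Vec (Term 𝒳 V) k) → rename₂* id ts ≡ ts
  rename₂-id (var x)     = refl
  rename₂-id (fn f ts)   = cong (fn f) (rename₂*-id ts)
  rename₂-id (meta X ts) = cong (meta X) (rename₂*-id ts)
  rename₂*-id []       = refl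
  rename₂*-id (t ∷ ts) = cong₂ _∷_ (rename₂-id t) (rename₂*-id ts)

  -- Patterns have to be linear and canonical. An arbitrary term therefore becomes a pattern body by
  -- giving each variable occurrence its own number, from left to right, and remembering in `labels`
  -- what stood there.
  record Linearisation (t : Term 𝒳 W) : Set where
    constructor linearisation
    field
      {arity} : ℕ
      skeleton : Term 𝒳 (Fin arity)
      labels : Vec W arity
      restore : bind (var ∘ lookup labels) skeleton ≡ t
      linear : vars skeleton ≡ allFin arity

  record Linearisation* (ts : Vec (Term 𝒳 W) k) : Set where
    constructor linearisation*
    field
      {arity} : ℕ
      skeleton : Vec (Term 𝒳 (Fin arity)) k
      labels : Vec W arity
      restore : bind* (var ∘ lookup labels) skeleton ≡ ts
      linear : vars* skeleton ≡ allFin arity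

  linearise  : (t : Term 𝒳 W) → Linearisation t
  linearise* : (ts : Vec (Term 𝒳 W) k) → Linearisation* ts
  linearise (var x) = linearisation (var zero) (x ∷ []) refl refl
  linearise (fn f ts) with linearise* ts
  ... | linearisation* us ws refl lin = linearisation (fn f us) ws refl lin
  linearise (meta X ts) with linearise* ts
  ... | linearisation* us ws refl lin = linearisation (meta X us) ws refl lin
  linearise* [] = linearisation* [] [] refl refl
  linearise* (t ∷ ts) with linearise t | linearise* ts
  ... | linearisation {m} u vs refl lin | linearisation* {n} us ws refl lin* =
    linearisation* (bind (var ∘ (_↑ˡ n)) u ∷ bind* (var ∘ (m ↑ʳ_)) us) (vs Vec.++ ws)
      (cong₂ _∷_
        (trans (bind-bind _ _ u) (bind-cong (cong var ∘ Vec.lookup-++ˡ vs ws) u))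
        (trans (bind*-bind* _ _ us)
               (bind*-cong-local us λ {i} _ → cong var (Vec.lookup-++ʳ vs ws i))))
      (trans (cong₂ _++_ (trans (vars-bind-var (_↑ˡ n) u) (cong (List.map (_↑ˡ n)) lin))
                         (trans (vars*-bind*-var us) (cong (List.map (m ↑ʳ_)) lin*)))
             (allFin-+ m n))
    where
    vars*-bind*-var : ∀ {k} {f : V → W} (ts : Vec (Term 𝒳 V) k) →
                      vars* (bind* (var ∘ f) ts) ≡ List.map f (vars* ts)
    vars*-bind*-var ts = trans (vars*-bind* _ ts)
      (trans (cong List.concat (List.map-∘ (vars* ts))) (List.concat-map-[_] _))

  -- A term whose variables are linear and carry witnesses amounts to a plain term
  -- together with a choice of witnesses.
  distribute : ∀ {n} {P : Fin n → Set} (t : Term 𝒳 (∃ P)) →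
               vars (bind (var ∘ proj₁) t) ≡ allFin n →
               Σ[ f ∈ (∀ i → P i) ] t ≡ bind (λ i → var (i , f i)) (bind (var ∘ proj₁) t)
  distribute {n = n} {P} t lin = (λ i → choose (vars t) lin′ (∈-allFin i)) , (begin
    t                                           ≡⟨ bind-var t ⟨
    bind var t                                  ≡⟨ bind-cong-local t (λ q∈ →
      cong var (choose-unique (vars t) lin′ (allFin⁺ n) q∈ (∈-allFin _))) ⟩
    bind (λ q → var (proj₁ q , choose (vars t) lin′ (∈-allFin (proj₁ q)))) t
                                                ≡⟨ bind-bind _ _ t ⟨
    bind (λ i → var (i , choose (vars t) lin′ (∈-allFin i))) (bind (var ∘ proj₁) t) ∎)
    where
    open ≡-Reasoning
    lin′ = trans (sym (vars-bind-var proj₁ t)) lin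

  -- The analogue for 2nd-order variables: in a canonical body, a substitution that was found
  -- occurrence by occurrence is a function of the 2nd-order variable.
  distribute₂ : ∀ {Γ} {P : ∀ {k} → k ∈ Γ → Set} (t : Term (λ k → Σ[ X ∈ k ∈ Γ ] P X) V) →
                metas (rename₂ proj₁ t) ≡ allMetas Γ →
                Σ[ f ∈ (∀ {k} (X : k ∈ Γ) → P X) ]
                  t ≡ rename₂ (λ X → X , f X) (rename₂ proj₁ t)
  distribute₂ {Γ = Γ} {P} t lin = (λ X → choose ps lin′ (∈-allMetas X)) , (begin
    t                                           ≡⟨ rename₂-id t ⟨
    rename₂ id t                                ≡⟨ rename₂-cong-local t (λ q∈ →
      assoc-injective (choose-unique ps lin′ (allMetas-unique Γ) (∈-map⁺ assoc q∈) (∈-allMetas _))) ⟩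
    rename₂ (λ q → proj₁ q , choose ps lin′ (∈-allMetas (proj₁ q))) t
                                                ≡⟨ rename₂-rename₂ _ proj₁ t ⟨
    rename₂ (λ X → X , choose ps lin′ (∈-allMetas X)) (rename₂ proj₁ t) ∎)
    where
    open ≡-Reasoning
    P′ : ∃ (_∈ Γ) → Set
    P′ (_ , X) = P X
    -- Regrouped so that the index is the pair of arity and variable, as listed by `allMetas`.
    assoc : ∃ (λ k → Σ[ X ∈ k ∈ Γ ] P X) → ∃ P′
    assoc (k , X , p) = (k , X) , p
    assoc-injective : ∀ {k} {X Y : k ∈ Γ} {p : P X} {q : P Y} →
                      _≡_ {A = ∃ P′} ((k , X) , p) ((k , Y) , q) →
                      _≡_ {A = Σ[ X ∈ k ∈ Γ ] P X} (X , p) (Y , q)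
    assoc-injective refl = refl
    ps = List.map assoc (metas t)
    lin′ : List.map proj₁ ps ≡ allMetas Γ
    lin′ = trans (sym (List.map-∘ (metas t))) (trans (sym (metas-rename₂ proj₁ t)) lin)
    ∈-allMetas : ∀ {Δ k} (X : k ∈ Δ) → (k , X) ∈ allMetas Δ
    ∈-allMetas {l ∷ Δ} (here refl) = here refl
    ∈-allMetas {l ∷ Δ} (there X)   =
      subst ((_ , there X) ∈_) (sym (allMetas-∷ l Δ)) (there (∈-map⁺ (under there) (∈-allMetas X)))
    allMetas-unique : ∀ Δ → ListUnique.Unique (allMetas Δ)
    allMetas-unique []      = AllPairs.[]
    allMetas-unique (l ∷ Δ) = subst ListUnique.Unique (sym (allMetas-∷ l Δ))
      (All.map⁺ (All.universal (λ _ ()) (allMetas Δ)) AllPairs.∷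
       map⁺ (λ { refl → refl }) (allMetas-unique Δ))

-- Decorated terms, their order and their validity.

module Decorations (Sym : ℕ → Set) where
  open Rewriting Sym hiding (var; fn; meta)
  open Rewriting using (var; fn; meta)
  open TermLemmas Sym

  -- A multipattern denoting t is encoded by decorating each function symbol of t
  -- with 0 if it belongs to no pattern, with 1 if it is the root of a pattern, and
  -- with 2 if it belongs to the same pattern as its parent. Refinement is then the
  -- pointwise order, and meets and joins are pointwise minima and maxima.
  module D = Rewriting (λ k → ℕ × Sym k)
  module DL = TermLemmas (λ k → ℕ × Sym k)

  Deco : Set → Set
  Deco = D.FO

  private variable
    U V W : Set
    k : ℕ

  erase  : Deco V → FO V
  erase* : Vec (Deco V) k → Vec (FO V) k
  erase (var x)          = var x
  erase (fn (_ , f) ms) = fn f (erase* ms)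
  erase (meta () _)
  erase* []       = []
  erase* (m ∷ ms) = erase m ∷ erase* ms

  bottom  : FO V → Deco V
  bottom* : Vec (FO V) k → Vec (Deco V) k
  bottom (var x)   = var x
  bottom (fn f ts) = fn (0 , f) (bottom* ts)
  bottom (meta () _)
  bottom* []       = []
  bottom* (t ∷ ts) = bottom t ∷ bottom* ts

  -- All symbols in one pattern. With s = 1 the pattern starts at the root; with s = 2 it continues
  -- that of the parent.
  full  : ℕ → FO V → Deco V
  full* : Vec (FO V) k → Vec (Deco V) k
  full s (var x)   = var x
  full s (fn f ts) = fn (s , f) (full* ts)
  full s (meta () _)
  full* []       = []
  full* (t ∷ ts) = full 2 t ∷ full* ts

  erase-bind   : (σ : V → Deco W) → ∀ m → erase (D.bind σ m) ≡ bind (erase ∘ σ) (erase m)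
  erase*-bind* : (σ : V → Deco W) (ms : Vec _ k) →
                 erase* (D.bind* σ ms) ≡ bind* (erase ∘ σ) (erase* ms)
  erase-bind σ (var x)   = refl
  erase-bind σ (fn f ms) = cong (fn _) (erase*-bind* σ ms)
  erase-bind σ (meta () _)
  erase*-bind* σ []       = refl
  erase*-bind* σ (m ∷ ms) = cong₂ _∷_ (erase-bind σ m) (erase*-bind* σ ms)

  erase-full   : ∀ s (t : FO V) → erase (full s t) ≡ t
  erase*-full* : (ts : Vec (FO V) k) → erase* (full* ts) ≡ ts
  erase-full s (var x)   = refl
  erase-full s (fn f ts) = cong (fn f) (erase*-full* ts)
  erase-full s (meta () _)
  erase*-full* []       = refl
  erase*-full* (t ∷ ts) = cong₂ _∷_ (erase-full 2 t) (erase*-full* ts)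

  vars-erase   : (m : Deco V) → vars (erase m) ≡ D.vars m
  vars*-erase* : (ms : Vec (Deco V) k) → vars* (erase* ms) ≡ D.vars* ms
  vars-erase (var x)   = refl
  vars-erase (fn f ms) = vars*-erase* ms
  vars-erase (meta () _)
  vars*-erase* []       = refl
  vars*-erase* (m ∷ ms) = cong₂ _++_ (vars-erase m) (vars*-erase* ms)

  vars-full : ∀ s (t : FO V) → D.vars (full s t) ≡ vars t
  vars-full s t = trans (sym (vars-erase (full s t))) (cong vars (erase-full s t))

  full-rename   : (f : V → W) → ∀ s t → full s (bind (var ∘ f) t) ≡ D.bind (var ∘ f) (full s t)
  full*-rename* : (f : V → W) (ts : Vec _ k) →
                  full* (bind* (var ∘ f) ts) ≡ D.bind* (var ∘ f) (full* ts)
  full-rename f s (var x)   = refl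
  full-rename f s (fn g ts) = cong (fn _) (full*-rename* f ts)
  full-rename f s (meta () _)
  full*-rename* f []       = refl
  full*-rename* f (t ∷ ts) = cong₂ _∷_ (full-rename f 2 t) (full*-rename* f ts)

  infix 4 _⊴_ _⊴*_

  data _⊴_ {V : Set} : Deco V → Deco V → Set
  data _⊴*_ {V : Set} : Vec (Deco V) k → Vec (Deco V) k → Set

  data _⊴_ where
    var : ∀ {x} → var x ⊴ var x
    fn  : ∀ {s s′} {f : Sym k} {ms ms′} → s ≤ s′ → ms ⊴* ms′ → fn (s , f) ms ⊴ fn (s′ , f) ms′

  data _⊴*_ where
    []  : [] ⊴* []
    _∷_ : ∀ {m m′} {ms ms′ : Vec _ k} → m ⊴ m′ → ms ⊴* ms′ → m ∷ ms ⊴* m′ ∷ ms′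

  ⊴-refl  : {m : Deco V} → m ⊴ m
  ⊴*-refl : {ms : Vec (Deco V) k} → ms ⊴* ms
  ⊴-refl {m = var x}   = var
  ⊴-refl {m = fn f ms} = fn ℕ.≤-refl ⊴*-refl
  ⊴-refl {m = meta () _}
  ⊴*-refl {ms = []}     = []
  ⊴*-refl {ms = m ∷ ms} = ⊴-refl ∷ ⊴*-refl

  ⊴-reflexive : {m m′ : Deco V} → m ≡ m′ → m ⊴ m′
  ⊴-reflexive refl = ⊴-refl

  ⊴-trans  : {l m n : Deco V} → l ⊴ m → m ⊴ n → l ⊴ n
  ⊴*-trans : {ls ms ns : Vec (Deco V) k} → ls ⊴* ms → ms ⊴* ns → ls ⊴* ns
  ⊴-trans var       var         = var
  ⊴-trans (fn s ms) (fn s′ ms′) = fn (ℕ.≤-trans s s′) (⊴*-trans ms ms′)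
  ⊴*-trans []       []         = []
  ⊴*-trans (m ∷ ms) (m′ ∷ ms′) = ⊴-trans m m′ ∷ ⊴*-trans ms ms′

  ⊴⇒erase≡   : {m n : Deco V} → m ⊴ n → erase m ≡ erase n
  ⊴*⇒erase*≡ : {ms ns : Vec (Deco V) k} → ms ⊴* ns → erase* ms ≡ erase* ns
  ⊴⇒erase≡ var      = refl
  ⊴⇒erase≡ (fn _ r) = cong (fn _) (⊴*⇒erase*≡ r)
  ⊴*⇒erase*≡ []       = refl
  ⊴*⇒erase*≡ (r ∷ rs) = cong₂ _∷_ (⊴⇒erase≡ r) (⊴*⇒erase*≡ rs)

  ⊴⇒vars≡ : {m n : Deco V} → m ⊴ n → D.vars m ≡ D.vars n
  ⊴⇒vars≡ {m = m} {n} r =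
    trans (sym (vars-erase m)) (trans (cong vars (⊴⇒erase≡ r)) (vars-erase n))

  module _ {σ τ : V → Deco W} (σ⊴τ : ∀ x → σ x ⊴ τ x) where
    bind-mono  : ∀ {m n} → m ⊴ n → D.bind σ m ⊴ D.bind τ n
    bind*-mono : {ms ns : Vec _ k} → ms ⊴* ns → D.bind* σ ms ⊴* D.bind* τ ns
    bind-mono var      = σ⊴τ _
    bind-mono (fn s r) = fn s (bind*-mono r)
    bind*-mono []       = []
    bind*-mono (r ∷ rs) = bind-mono r ∷ bind*-mono rs

  bottom-least  : (m : Deco V) → bottom (erase m) ⊴ m
  bottom*-least : (ms : Vec (Deco V) k) → bottom* (erase* ms) ⊴* ms
  bottom-least (var x)   = var
  bottom-least (fn f ms) = fn z≤n (bottom*-least ms)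
  bottom-least (meta () _)
  bottom*-least []       = []
  bottom*-least (m ∷ ms) = bottom-least m ∷ bottom*-least ms

  -- Valid c m: the root of m is decorated with at most c, and a symbol is decorated
  -- with 2 only if its parent belongs to a pattern.
  data Valid {V : Set} (c : ℕ) : Deco V → Set
  data Valid* {V : Set} (c : ℕ) : Vec (Deco V) k → Set

  data Valid c where
    var : ∀ {x} → Valid c (var x)
    fn  : ∀ {s} {f : Sym k} {ms} → s ≤ c → Valid* (suc (1 ℕ.⊓ s)) ms → Valid c (fn (s , f) ms)

  data Valid* c where
    []  : Valid* c []
    _∷_ : ∀ {m} {ms : Vec _ k} → Valid c m → Valid* c ms → Valid* c (m ∷ ms)

  valid-weaken  : ∀ {c d} → c ≤ d → {m : Deco V} → Valid c m → Valid d m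
  valid*-weaken : ∀ {c d} → c ≤ d → {ms : Vec (Deco V) k} → Valid* c ms → Valid* d ms
  valid-weaken c≤d var       = var
  valid-weaken c≤d (fn s vs) = fn (ℕ.≤-trans s c≤d) vs
  valid*-weaken c≤d []       = []
  valid*-weaken c≤d (v ∷ vs) = valid-weaken c≤d v ∷ valid*-weaken c≤d vs

  -- Below the root no valid decoration exceeds 2, a value that `full` attains everywhere. For c = 1
  -- this says that a single pattern is the top of the lattice.
  ⊴-full    : ∀ {c} {m : Deco V} → Valid c m → m ⊴ full c (erase m)
  ⊴*-full*  : ∀ {c} → c ≤ 2 → {ms : Vec (Deco V) k} → Valid* c ms → ms ⊴* full* (erase* ms)
  ⊴-full var             = var
  ⊴-full (fn {s = s} s≤c vs) = fn s≤c (⊴*-full* (s≤s (ℕ.m⊓n≤m 1 s)) vs)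
  ⊴*-full* c≤2 []       = []
  ⊴*-full* c≤2 (v ∷ vs) = ⊴-full (valid-weaken c≤2 v) ∷ ⊴*-full* c≤2 vs

  full-valid   : ∀ {s} → 1 ≤ s → (t : FO V) → Valid s (full s t)
  full*-valid* : (ts : Vec (FO V) k) → Valid* 2 (full* ts)
  full-valid 1≤s (var x)   = var
  full-valid {s = s} 1≤s (fn f ts) = fn ℕ.≤-refl
    (subst (λ c → Valid* (suc c) (full* ts)) (sym (ℕ.m≤n⇒m⊓n≡m 1≤s)) (full*-valid* ts))
  full-valid 1≤s (meta () _)
  full*-valid* []       = []
  full*-valid* (t ∷ ts) = full-valid (s≤s z≤n) t ∷ full*-valid* ts

  module _ {σ : V → Deco W} (σ-valid : ∀ x → Valid 1 (σ x)) where
    -- A root decorated with at most 1 makes no demand on its parent, so it may be plugged in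
    -- anywhere.
    bind-valid   : ∀ {c m} → 1 ≤ c → Valid c m → Valid c (D.bind σ m)
    bind*-valid* : ∀ {c} {ms : Vec _ k} → 1 ≤ c → Valid* c ms → Valid* c (D.bind* σ ms)
    bind-valid 1≤c var        = valid-weaken 1≤c (σ-valid _)
    bind-valid 1≤c (fn s≤ vs) = fn s≤ (bind*-valid* (s≤s z≤n) vs)
    bind*-valid* 1≤c []       = []
    bind*-valid* 1≤c (v ∷ vs) = bind-valid 1≤c v ∷ bind*-valid* 1≤c vs

  valid-lookup : ∀ {c} {ms : Vec (Deco V) k} → Valid* c ms → ∀ i → Valid c (lookup ms i)
  valid-lookup (v ∷ vs) zero    = v
  valid-lookup (v ∷ vs) (suc i) = valid-lookup vs i

  -- Pointwise combination of decorations.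

  module _ (op : ℕ → ℕ → ℕ) where

    -- A relation rather than a function: it is defined only for decorations of the same term, and
    -- it is also read backwards, in `zip-unbind`.
    data Zip {V : Set} : (l m n : Deco V) → Set
    data Zip* {V : Set} : (ls ms ns : Vec (Deco V) k) → Set

    data Zip where
      var : ∀ {x} → Zip (var x) (var x) (var x)
      fn  : ∀ {s s′} {f : Sym k} {ls ms ns} → Zip* ls ms ns →
            Zip (fn (s , f) ls) (fn (s′ , f) ms) (fn (op s s′ , f) ns)

    data Zip* where
      []  : Zip* [] [] []
      _∷_ : ∀ {l m n} {ls ms ns : Vec _ k} → Zip l m n → Zip* ls ms ns →
            Zip* (l ∷ ls) (m ∷ ms) (n ∷ ns)

  module _ {op : ℕ → ℕ → ℕ} where

    zip-exists  : (l m : Deco V) → erase l ≡ erase m → ∃ (Zip op l m)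
    zip*-exists : (ls ms : Vec (Deco V) k) → erase* ls ≡ erase* ms → ∃ (Zip* op ls ms)
    zip-exists (var x)   (var .x)  refl = _ , var
    zip-exists (fn f ls) (fn g ms) eq with fn-injective eq
    ... | refl , refl , eq* = _ , fn (proj₂ (zip*-exists ls ms eq*))
    zip-exists (meta () _)
    zip-exists (var x) (meta () _)
    zip-exists (fn f ls) (meta () _)
    zip*-exists []       []       _  = _ , []
    zip*-exists (l ∷ ls) (m ∷ ms) eq =
      _ , proj₂ (zip-exists l m (Vec.∷-injectiveˡ eq))
        ∷ proj₂ (zip*-exists ls ms (Vec.∷-injectiveʳ eq))

    module _ {σ τ ρ : V → Deco W} (z : ∀ x → Zip op (σ x) (τ x) (ρ x)) where
      zip-bind   : ∀ {l m n} → Zip op l m n → Zip op (D.bind σ l) (D.bind τ m) (D.bind ρ n)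
      zip*-bind* : {ls ms ns : Vec _ k} → Zip* op ls ms ns →
                   Zip* op (D.bind* σ ls) (D.bind* τ ms) (D.bind* ρ ns)
      zip-bind var     = z _
      zip-bind (fn zs) = fn (zip*-bind* zs)
      zip*-bind* []       = []
      zip*-bind* (z ∷ zs) = zip-bind z ∷ zip*-bind* zs

    module _ {σ τ ρ : V → Deco W} where
      -- The comparisons with n give the three contexts the same shape. Their holes then line up,
      -- and a pointwise combination can be separated into that of the contexts and those of the
      -- contents of the holes.
      zip-unbind   : ∀ {l m n} → l ⊴ n → m ⊴ n → Zip op (D.bind σ l) (D.bind τ m) (D.bind ρ n) →
                     Zip op l m n × (∀ {x} → x ∈ D.vars n → Zip op (σ x) (τ x) (ρ x))
      zip*-unbind* : {ls ms ns : Vec _ k} → ls ⊴* ns → ms ⊴* ns →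
                     Zip* op (D.bind* σ ls) (D.bind* τ ms) (D.bind* ρ ns) →
                     Zip* op ls ms ns × (∀ {x} → x ∈ D.vars* ns → Zip op (σ x) (τ x) (ρ x))
      zip-unbind var      var      z      = var , λ { (here refl) → z }
      zip-unbind (fn _ p) (fn _ q) (fn z) = Product.map₁ fn (zip*-unbind* p q z)
      zip*-unbind* []       []       []       = [] , λ ()
      zip*-unbind* {ns = n ∷ _} (p ∷ ps) (q ∷ qs) (z ∷ zs) =
        let z₀ , z₁ = zip-unbind p q z
            zs₀ , zs₁ = zip*-unbind* ps qs zs
        in z₀ ∷ zs₀ , λ x∈ → case ∈-++⁻ (D.vars n) x∈ of λ where
             (inj₁ x∈n)  → z₁ x∈n
             (inj₂ x∈ns) → zs₁ x∈ns

    module _ (op≤ : ∀ s s′ → op s s′ ≤ s) where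
      zip-lowerˡ  : {l m n : Deco V} → Zip op l m n → n ⊴ l
      zip*-lowerˡ : {ls ms ns : Vec (Deco V) k} → Zip* op ls ms ns → ns ⊴* ls
      zip-lowerˡ var     = var
      zip-lowerˡ (fn zs) = fn (op≤ _ _) (zip*-lowerˡ zs)
      zip*-lowerˡ []       = []
      zip*-lowerˡ (z ∷ zs) = zip-lowerˡ z ∷ zip*-lowerˡ zs

    module _ (≤op : ∀ s s′ → s ≤ op s s′) where
      zip-upperˡ  : {l m n : Deco V} → Zip op l m n → l ⊴ n
      zip*-upperˡ : {ls ms ns : Vec (Deco V) k} → Zip* op ls ms ns → ls ⊴* ns
      zip-upperˡ var     = var
      zip-upperˡ (fn zs) = fn (≤op _ _) (zip*-upperˡ zs)
      zip*-upperˡ []       = []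
      zip*-upperˡ (z ∷ zs) = zip-upperˡ z ∷ zip*-upperˡ zs

    module _ (glb : ∀ {s s′ c} → c ≤ s → c ≤ s′ → c ≤ op s s′) where
      zip-greatest  : {l m n o : Deco V} → Zip op l m n → o ⊴ l → o ⊴ m → o ⊴ n
      zip*-greatest : {ls ms ns os : Vec (Deco V) k} → Zip* op ls ms ns →
                      os ⊴* ls → os ⊴* ms → os ⊴* ns
      zip-greatest var     var      var      = var
      zip-greatest (fn zs) (fn s p) (fn r q) = fn (glb s r) (zip*-greatest zs p q)
      zip*-greatest []       []       []       = []
      zip*-greatest (z ∷ zs) (p ∷ ps) (q ∷ qs) = zip-greatest z p q ∷ zip*-greatest zs ps qs

    module _ (lub : ∀ {s s′ c} → s ≤ c → s′ ≤ c → op s s′ ≤ c) where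
      zip-least  : {l m n o : Deco V} → Zip op l m n → l ⊴ o → m ⊴ o → n ⊴ o
      zip*-least : {ls ms ns os : Vec (Deco V) k} → Zip* op ls ms ns →
                   ls ⊴* os → ms ⊴* os → ns ⊴* os
      zip-least var     var      var      = var
      zip-least (fn zs) (fn s p) (fn r q) = fn (lub s r) (zip*-least zs p q)
      zip*-least []       []       []       = []
      zip*-least (z ∷ zs) (p ∷ ps) (q ∷ qs) = zip-least z p q ∷ zip*-least zs ps qs

    module _ (mono : ∀ {a b c d} → a ≤ b → c ≤ d → op a c ≤ op b d)
             (homo : ∀ s s′ → suc (1 ℕ.⊓ op s s′) ≡ op (suc (1 ℕ.⊓ s)) (suc (1 ℕ.⊓ s′))) where
      zip-valid  : ∀ {c d} {l m n : Deco V} → Zip op l m n →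
                   Valid c l → Valid d m → Valid (op c d) n
      zip*-valid : ∀ {c d} {ls ms ns : Vec (Deco V) k} → Zip* op ls ms ns →
                   Valid* c ls → Valid* d ms → Valid* (op c d) ns
      zip-valid var var var = var
      zip-valid (fn {s = s} {s′} {ns = ns} zs) (fn s≤ vs) (fn s′≤ ws) = fn (mono s≤ s′≤)
        (subst (λ c → Valid* c ns) (sym (homo s s′)) (zip*-valid zs vs ws))
      zip*-valid []       []       []       = []
      zip*-valid (z ∷ zs) (v ∷ vs) (w ∷ ws) = zip-valid z v w ∷ zip*-valid zs vs ws

  zip-resp : ∀ {op} {l l′ m m′ n n′ : Deco V} → l ≡ l′ → m ≡ m′ → n ≡ n′ →
             Zip op l m n → Zip op l′ m′ n′
  zip-resp refl refl refl z = z

  zip-sym  : ∀ {op} → (∀ s s′ → op s s′ ≡ op s′ s) → {l m n : Deco V} → Zip op l m n → Zip op m l n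
  zip*-sym : ∀ {op} → (∀ s s′ → op s s′ ≡ op s′ s) → {ls ms ns : Vec (Deco V) k} →
             Zip* op ls ms ns → Zip* op ms ls ns
  zip-sym comm var = var
  zip-sym comm (fn {s = s} {s′} zs) rewrite comm s s′ = fn (zip*-sym comm zs)
  zip*-sym comm []       = []
  zip*-sym comm (z ∷ zs) = zip-sym comm z ∷ zip*-sym comm zs

  -- The bound `suc (1 ⊓ s)` on the children of a symbol decorated with s, which is 1 for s = 0 and
  -- 2 otherwise, is monotone in s. It therefore commutes with minima, and likewise with maxima.
  meet-valid : {l m n : Deco V} → Zip ℕ._⊓_ l m n → Valid 1 l → Valid 1 m → Valid 1 n
  meet-valid = zip-valid ℕ.⊓-mono-≤ λ s s′ →
    ℕ.mono-≤-distrib-⊓ {f = λ s → suc (1 ℕ.⊓ s)} (s≤s ∘ ℕ.⊓-monoʳ-≤ 1) s s′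

  join-valid : {l m n : Deco V} → Zip ℕ._⊔_ l m n → Valid 1 l → Valid 1 m → Valid 1 n
  join-valid = zip-valid ℕ.⊔-mono-≤ λ s s′ →
    ℕ.mono-≤-distrib-⊔ {f = λ s → suc (1 ℕ.⊓ s)} (s≤s ∘ ℕ.⊓-monoʳ-≤ 1) s s′

  -- From terms with patterns to decorations, and cutting along a bound.

  module Marking {B : ℕ → Set} (pat : ∀ {k} → B k → Pattern k) where

    -- The names `B` are left open so that the same map serves rule symbols via their left-hand
    -- sides, patterns standing for themselves, and the 2nd-order variables of a let-expression via
    -- its bindings.
    mark  : Term B V → Deco V
    mark* : Vec (Term B V) k → Vec (Deco V) k
    mark (var x)     = var x
    mark (fn f ts)   = fn (0 , f) (mark* ts)
    mark (meta b ts) = D.bind (lookup (mark* ts)) (full 1 (Pattern.term (pat b)))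
    mark* []       = []
    mark* (t ∷ ts) = mark t ∷ mark* ts

    mark*-map : (ts : Vec (Term B V) k) → mark* ts ≡ map mark ts
    mark*-map []       = refl
    mark*-map (t ∷ ts) = cong (_ ∷_) (mark*-map ts)

    lookup-mark* : (ts : Vec (Term B V) k) → lookup (mark* ts) ≗ mark ∘ lookup ts
    lookup-mark* ts i = trans (cong (λ ms → lookup ms i) (mark*-map ts)) (Vec.lookup-map i _ ts)

    mark-bind   : (σ : V → Term B W) → ∀ t → mark (bind σ t) ≡ D.bind (mark ∘ σ) (mark t)
    mark*-bind* : (σ : V → Term B W) (ts : Vec _ k) →
                  mark* (bind* σ ts) ≡ D.bind* (mark ∘ σ) (mark* ts)
    mark-bind σ (var x)     = refl
    mark-bind σ (fn f ts)   = cong (fn _) (mark*-bind* σ ts)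
    mark-bind σ (meta b ts) =
      trans (cong (λ ms → D.bind (lookup ms) p) (mark*-bind* σ ts))
            (trans (DL.bind-cong (DL.lookup-bind* _ (mark* ts)) p) (sym (DL.bind-bind _ _ p)))
      where p = full 1 (Pattern.term (pat b))
    mark*-bind* σ []       = refl
    mark*-bind* σ (t ∷ ts) = cong₂ _∷_ (mark-bind σ t) (mark*-bind* σ ts)

    vars-mark   : (t : Term B V) → D.vars (mark t) ≡ vars t
    vars*-mark* : (ts : Vec (Term B V) k) → D.vars* (mark* ts) ≡ vars* ts
    vars-mark (var x)     = refl
    vars-mark (fn f ts)   = vars*-mark* ts
    vars-mark (meta {k} b ts) = begin
      D.vars (D.bind (lookup ms) (full 1 p))           ≡⟨ DL.vars-bind (lookup ms) (full 1 p) ⟩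
      concatMap (D.vars ∘ lookup ms) (D.vars (full 1 p))
        ≡⟨ cong (concatMap _) (trans (vars-full 1 p) (Pattern.canonical (pat b))) ⟩
      concatMap (D.vars ∘ lookup ms) (allFin k)        ≡⟨ concatMap-lookup-allFin D.vars ms ⟩
      List.concat (Vec.toList (map D.vars ms))         ≡⟨ DL.vars*-map ms ⟨
      D.vars* ms                                       ≡⟨ vars*-mark* ts ⟩
      vars* ts                                         ∎
      where
      open ≡-Reasoning
      ms = mark* ts
      p = Pattern.term (pat b)
    vars*-mark* []       = refl
    vars*-mark* (t ∷ ts) = cong₂ _++_ (vars-mark t) (vars*-mark* ts)

    erase-mark   : (t : Term B V) → erase (mark t) ≡ subst₂ (Pattern.term ∘ pat) t
    erase*-mark* : (ts : Vec (Term B V) k) → erase* (mark* ts) ≡ subst₂* (Pattern.term ∘ pat) ts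
    erase-mark (var x)     = refl
    erase-mark (fn f ts)   = cong (fn f) (erase*-mark* ts)
    erase-mark (meta b ts) = begin
      erase (D.bind (lookup (mark* ts)) (full 1 p))      ≡⟨ erase-bind _ (full 1 p) ⟩
      bind (erase ∘ lookup (mark* ts)) (erase (full 1 p)) ≡⟨ cong (bind _) (erase-full 1 p) ⟩
      bind (erase ∘ lookup (mark* ts)) p
        ≡⟨ bind-cong (λ i → trans (lookup-erase* (mark* ts) i)
                                  (cong (λ us → lookup us i) (erase*-mark* ts))) p ⟩
      bind (lookup (subst₂* (Pattern.term ∘ pat) ts)) p  ∎
      where
      open ≡-Reasoning
      p = Pattern.term (pat b)
      lookup-erase* : ∀ {k} (ms : Vec (Deco V) k) i → erase (lookup ms i) ≡ lookup (erase* ms) i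
      lookup-erase* (m ∷ ms) zero    = refl
      lookup-erase* (m ∷ ms) (suc i) = lookup-erase* ms i
    erase*-mark* []       = refl
    erase*-mark* (t ∷ ts) = cong₂ _∷_ (erase-mark t) (erase*-mark* ts)

    mark-valid   : (t : Term B V) → Valid 1 (mark t)
    mark*-valid* : (ts : Vec (Term B V) k) → Valid* 1 (mark* ts)
    mark-valid (var x)     = var
    mark-valid (fn f ts)   = fn z≤n (mark*-valid* ts)
    mark-valid (meta b ts) = bind-valid (valid-lookup (mark*-valid* ts)) (s≤s z≤n)
                                        (full-valid (s≤s z≤n) (Pattern.term (pat b)))
    mark*-valid* []       = []
    mark*-valid* (t ∷ ts) = mark-valid t ∷ mark*-valid* ts

    -- Each leaf of `cutting` holds a hole of m together with the piece of t found there. Reading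
    -- the pieces gives t back; reading the holes gives the part of t above the cut.
    record Cut (t : Term B V) (m : Deco W) (τ : W → Deco V) : Set where
      constructor mkCut
      field
        cutting : Term B (Σ[ w ∈ W ] Σ[ t′ ∈ Term B V ] mark t′ ⊴ τ w)
        restore : bind (proj₁ ∘ proj₂) cutting ≡ t
        bounded : mark (bind (var ∘ proj₁) cutting) ⊴ m

    record Cut* (ts : Vec (Term B V) k) (ms : Vec (Deco W) k) (τ : W → Deco V) : Set where
      constructor mkCut*
      field
        cutting : Vec (Term B (Σ[ w ∈ W ] Σ[ t′ ∈ Term B V ] mark t′ ⊴ τ w)) k
        restore : bind* (proj₁ ∘ proj₂) cutting ≡ ts
        bounded : mark* (bind* (var ∘ proj₁) cutting) ⊴* ms

    -- Since the roots of the τ w are not joined to their parents, a pattern that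
    -- starts within m also ends within m.
    module _ {V W : Set} {τ : W → Deco V} (τ-valid : ∀ w → Valid 1 (τ w)) where

      module _ {U : Set} (σ : U → Deco V) where

        Part : U → Set
        Part u = Σ[ m ∈ Deco W ] σ u ⊴ D.bind τ m

        ¬inner⊴ : ∀ {f : Sym k} {ms : Vec (Deco V) k} {m} → Valid 1 m → ¬ fn (2 , f) ms ⊴ m
        ¬inner⊴ (fn s≤1 _) (fn 2≤s _) = contradiction (ℕ.≤-trans 2≤s s≤1) λ { (s≤s ()) }

        -- Walking down p and m together, no hole of m is met at a symbol of p: that symbol is
        -- decorated with 2, the root of `τ w` with at most 1. So the variables of p are reached
        -- within m, and the rest of m is recorded there.
        peel  : ∀ p m → D.bind σ (full 2 p) ⊴ D.bind τ m →
                Σ[ q ∈ FO (∃ Part) ] bind (var ∘ proj₁) q ≡ p ×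
                                     D.bind (proj₁ ∘ proj₂) (full 2 q) ⊴ m
        peel* : (ps : Vec _ k) → ∀ ms → D.bind* σ (full* ps) ⊴* D.bind* τ ms →
                Σ[ qs ∈ Vec (FO (∃ Part)) k ] bind* (var ∘ proj₁) qs ≡ ps ×
                                     D.bind* (proj₁ ∘ proj₂) (full* qs) ⊴* ms
        peel (var u)   m       r        = var (u , m , r) , refl , ⊴-refl
        peel (fn f ps) (var w) r        = contradiction r (¬inner⊴ (τ-valid w))
        peel (fn f ps) (fn _ ms) (fn s r) =
          let qs , eq , r′ = peel* ps ms r in fn f qs , cong (fn f) eq , fn s r′
        peel (meta () _)
        peel (fn f ps) (meta () _)
        peel* []       []       []       = [] , refl , []
        peel* (p ∷ ps) (m ∷ ms) (r ∷ rs) =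
          let q , eq , r′ = peel p m r
              qs , eq* , rs′ = peel* ps ms rs
          in q ∷ qs , cong₂ _∷_ eq eq* , r′ ∷ rs′

      -- The root of p is decorated with 1 and might coincide with the root of some `τ w`, hence the
      -- restriction to an m that starts with a symbol. As p is linear, the recorded rests of m form
      -- a function of its arguments.
      split : ∀ {k l} (σ : Fin k → Deco V) (p : Pattern k) {f : ℕ × Sym l} {ms} →
              D.bind σ (full 1 (Pattern.term p)) ⊴ D.bind τ (fn f ms) →
              Σ[ parts ∈ (∀ i → Part σ i) ]
                D.bind (proj₁ ∘ parts) (full 1 (Pattern.term p)) ⊴ fn f ms
      split σ (pattern′ (fn g ps) (fn _ _) lin) {ms = ms} (fn s r) =
        let qs , eq , r′ = peel* σ ps ms r
            parts , eq′ = distribute (fn g qs) (trans (cong (vars ∘ fn g) eq) lin)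
            eq″ = trans eq′ (cong (bind (λ i → var (i , parts i)) ∘ fn g) eq)
        in parts , ⊴-trans (⊴-reflexive (sym
             (trans (cong (D.bind (proj₁ ∘ proj₂) ∘ full 1) eq″)
                    (trans (cong (D.bind (proj₁ ∘ proj₂))
                                 (full-rename (λ i → i , parts i) 1 (fn g ps)))
                           (DL.bind-bind (proj₁ ∘ proj₂) _ (full 1 (fn g ps)))))))
             (fn s r′)

      -- A hole of m is recognised before t is inspected, so a pattern that starts exactly at a hole
      -- belongs to the piece below the cut.
      cut   : (t : Term B V) (m : Deco W) → mark t ⊴ D.bind τ m → Cut t m τ
      cut*  : (ts : Vec (Term B V) k) (ms : Vec (Deco W) k) → mark* ts ⊴* D.bind* τ ms → Cut* ts ms τ
      -- Descending along `ts` to its i-th entry keeps the recursion structural. The bound m is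
      -- arbitrary here, since the rests of the bound found by `split` lie at varying depths.
      cutAt : (ts : Vec (Term B V) k) (i : Fin k) (m : Deco W) → lookup (mark* ts) i ⊴ D.bind τ m →
              Cut (lookup ts i) m τ
      cut t         (var w)   r        = mkCut (var (w , t , r)) refl var
      cut (fn f ts) (fn _ ms) (fn s r) =
        let mkCut* cs eq bd = cut* ts ms r in mkCut (fn f cs) (cong (fn f) eq) (fn s bd)
      cut (meta b ts) (fn f ms) r =
        let parts , parts⊴ = split (lookup (mark* ts)) (pat b) r
            cuts = λ i → cutAt ts i (proj₁ (parts i)) (proj₂ (parts i))
            cs = Vec.tabulate (Cut.cutting ∘ cuts)
            bounded : ∀ i → lookup (mark* (bind* (var ∘ proj₁) cs)) i ⊴ proj₁ (parts i)
            bounded i = ⊴-trans (⊴-reflexive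
              (trans (lookup-mark* (bind* (var ∘ proj₁) cs) i)
                     (cong mark (trans (lookup-bind* (var ∘ proj₁) cs i)
                       (cong (bind (var ∘ proj₁)) (Vec.lookup∘tabulate (Cut.cutting ∘ cuts) i))))))
              (Cut.bounded (cuts i))
        in mkCut (meta b cs)
             (cong (meta b) (trans (bind*-map _ cs)
               (trans (sym (Vec.tabulate-∘ _ _))
                      (trans (Vec.tabulate-cong (Cut.restore ∘ cuts)) (Vec.tabulate∘lookup ts)))))
             (⊴-trans (bind-mono bounded (⊴-refl {m = full 1 (Pattern.term (pat b))})) parts⊴)
      cut (fn f ts) (meta () _)
      cut (var x) (meta () _)
      cut (meta b ts) (meta () _)
      cut* []       []       []       = mkCut* [] refl []
      cut* (t ∷ ts) (m ∷ ms) (r ∷ rs) =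
        let mkCut c eq bd = cut t m r
            mkCut* cs eq* bd* = cut* ts ms rs
        in mkCut* (c ∷ cs) (cong₂ _∷_ eq eq*) (bd ∷ bd*)
      cutAt (t ∷ ts) zero    m r = cut t m r
      cutAt (t ∷ ts) (suc i) m r = cutAt ts i m r

    record Decomposition {n} (t : Term B V) (m : Deco (Fin n)) (τ : Fin n → Deco V) : Set where
      constructor decomposition
      field
        top      : Term B (Fin n)
        parts    : Fin n → Term B V
        restore  : bind parts top ≡ t
        top⊴     : mark top ⊴ m
        parts⊴   : ∀ i → mark (parts i) ⊴ τ i

    -- Comparable decorations have the same variables, so the part above the cut is as linear as m.
    -- Each hole then receives exactly one piece.
    decompose : ∀ {n} {m : Deco (Fin n)} {τ : Fin n → Deco V} → D.vars m ≡ allFin n →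
                (∀ i → Valid 1 (τ i)) → (t : Term B V) → mark t ⊴ D.bind τ m → Decomposition t m τ
    decompose {m = m} lin τ-valid t r =
      let mkCut c eq bd = cut τ-valid t m r
          top = bind (var ∘ proj₁) c
          parts , eq′ = distribute c (trans (sym (vars-mark top)) (trans (⊴⇒vars≡ bd) lin))
      in decomposition top (proj₁ ∘ parts)
           (trans (sym (bind-bind (proj₁ ∘ proj₂) _ top))
                  (trans (cong (bind (proj₁ ∘ proj₂)) (sym eq′)) eq))
           bd (proj₂ ∘ parts)

  module _ {B C : ℕ → Set} {pat : ∀ {k} → C k → Pattern k} (ρ : ∀ {k} → B k → C k) where
    open Marking

    mark-rename₂   : (t : Term B V) → mark pat (rename₂ ρ t) ≡ mark (pat ∘ ρ) t
    mark*-rename₂* : (ts : Vec (Term B V) k) → mark* pat (rename₂* ρ ts) ≡ mark* (pat ∘ ρ) ts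
    mark-rename₂ (var x)     = refl
    mark-rename₂ (fn f ts)   = cong (fn _) (mark*-rename₂* ts)
    mark-rename₂ (meta b ts) =
      cong (λ ms → D.bind (lookup ms) (full 1 (Pattern.term (pat (ρ b))))) (mark*-rename₂* ts)
    mark*-rename₂* []       = refl
    mark*-rename₂* (t ∷ ts) = cong₂ _∷_ (mark-rename₂ t) (mark*-rename₂* ts)

  -- From valid decorations back to terms with patterns.

  Annotated : Set → Set
  Annotated = Term Pattern

  open Marking {Pattern} id

  -- The leaves of `ss` are the subterms below the pattern. They become its arguments, one for each
  -- occurrence.
  abstracted : Sym k → Vec (FO (Annotated V)) k → Annotated V
  abstracted f ss = meta (pattern′ (fn f skeleton) (fn f skeleton) linear) labels
    where open Linearisation* (linearise* ss)

  mark-abstracted : (f : Sym k) (ss : Vec (FO (Annotated V)) k) →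
                    mark (abstracted f ss) ≡ fn (1 , f) (D.bind* mark (full* ss))
  mark-abstracted f ss with linearise* ss
  ... | linearisation* us ts refl _ = cong (fn _) (sym (begin
    D.bind* mark (full* (bind* (var ∘ lookup ts) us))
      ≡⟨ cong (D.bind* mark) (full*-rename* (lookup ts) us) ⟩
    D.bind* mark (D.bind* (var ∘ lookup ts) (full* us))
      ≡⟨ DL.bind*-bind* mark _ (full* us) ⟩
    D.bind* (mark ∘ lookup ts) (full* us)
      ≡⟨ DL.bind*-cong-local (full* us) (λ {i} _ → lookup-mark* ts i) ⟨
    D.bind* (lookup (mark* ts)) (full* us) ∎))
    where open ≡-Reasoning

  to   : Deco V → Annotated V
  to*  : Vec (Deco V) k → Vec (Annotated V) k
  -- The remainder of a pattern of which the parent is a part.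
  toʳ  : Deco V → FO (Annotated V)
  toʳ* : Vec (Deco V) k → Vec (FO (Annotated V)) k
  to (var x)              = var x
  to (fn (zero  , f) ms)  = fn f (to* ms)
  -- Under `Valid 1` only 1 occurs here; larger values are treated alike by default.
  to (fn (suc _ , f) ms)  = abstracted f (toʳ* ms)
  to (meta () _)
  to* []       = []
  to* (m ∷ ms) = to m ∷ to* ms
  toʳ (var x)                   = var (var x)
  toʳ (fn (zero , f) ms)        = var (fn f (to* ms))
  toʳ (fn (suc zero , f) ms)    = var (abstracted f (toʳ* ms))
  toʳ (fn (suc (suc _) , f) ms) = fn f (toʳ* ms)
  toʳ (meta () _)
  toʳ* []       = []
  toʳ* (m ∷ ms) = toʳ m ∷ toʳ* ms

  -- Together with the closure of validity under minima and maxima, this provides the terms that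
  -- realise meets and joins.
  mark-to   : {m : Deco V} → Valid 1 m → mark (to m) ≡ m
  mark*-to* : {ms : Vec (Deco V) k} → Valid* 1 ms → mark* (to* ms) ≡ ms
  mark-toʳ   : {m : Deco V} → Valid 2 m → D.bind mark (full 2 (toʳ m)) ≡ m
  mark*-toʳ* : {ms : Vec (Deco V) k} → Valid* 2 ms → D.bind* mark (full* (toʳ* ms)) ≡ ms
  mark-to var = refl
  mark-to (fn {s = zero}     _ vs) = cong (fn _) (mark*-to* vs)
  mark-to (fn {s = suc zero} _ vs) =
    trans (mark-abstracted _ _) (cong (fn _) (mark*-toʳ* vs))
  mark-to (fn {s = suc (suc _)} (s≤s ()) _)
  mark*-to* []       = refl
  mark*-to* (v ∷ vs) = cong₂ _∷_ (mark-to v) (mark*-to* vs)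
  mark-toʳ var = refl
  mark-toʳ (fn {s = zero}     _ vs) = cong (fn _) (mark*-to* vs)
  mark-toʳ (fn {s = suc zero} _ vs) =
    trans (mark-abstracted _ _) (cong (fn _) (mark*-toʳ* vs))
  mark-toʳ (fn {s = suc (suc zero)} _ vs) = cong (fn _) (mark*-toʳ* vs)
  mark-toʳ (fn {s = suc (suc (suc _))} (s≤s (s≤s ())) _)
  mark*-toʳ* []       = refl
  mark*-toʳ* (v ∷ vs) = cong₂ _∷_ (mark-toʳ v) (mark*-toʳ* vs)

-- Let-expressions and their inlined forms.

module Lets (Sym : ℕ → Set) where
  open Rewriting Sym
  open TermLemmas Sym
  open Decorations Sym
  open Marking

  private variable
    B C : ℕ → Set
    V W : Set
    k : ℕ

  lookup-++⁺ˡ : ∀ {Γ Δ} (bs : All B Γ) (cs : All B Δ) (X : k ∈ Γ) →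
                All.lookup (All.++⁺ bs cs) (∈-++⁺ˡ X) ≡ All.lookup bs X
  lookup-++⁺ˡ (b ∷ bs) cs (here refl) = refl
  lookup-++⁺ˡ (b ∷ bs) cs (there X)   = lookup-++⁺ˡ bs cs X

  lookup-++⁺ʳ : ∀ {Γ Δ} (bs : All B Γ) (cs : All B Δ) (X : k ∈ Δ) →
                All.lookup (All.++⁺ bs cs) (∈-++⁺ʳ Γ X) ≡ All.lookup cs X
  lookup-++⁺ʳ []       cs X = refl
  lookup-++⁺ʳ (b ∷ bs) cs X = lookup-++⁺ʳ bs cs X

  rename₂-bodyOf   : (t : Term B V) → rename₂ (All.lookup (bindingsOf t)) (bodyOf t) ≡ t
  rename₂*-bodyOf* : (ts : Vec (Term B V) k) → rename₂* (All.lookup (bindingsOf* ts)) (bodyOf* ts) ≡ ts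
  rename₂-bodyOf (var x)     = refl
  rename₂-bodyOf (fn f ts)   = cong (fn f) (rename₂*-bodyOf* ts)
  rename₂-bodyOf (meta b ts) =
    cong (meta b) (trans (rename₂*-rename₂* _ there (bodyOf* ts)) (rename₂*-bodyOf* ts))
  rename₂*-bodyOf* []       = refl
  rename₂*-bodyOf* (t ∷ ts) = cong₂ _∷_
    (trans (rename₂-rename₂ _ ∈-++⁺ˡ (bodyOf t))
      (trans (rename₂-cong-local (bodyOf t) λ {_ X} _ → lookup-++⁺ˡ (bindingsOf t) (bindingsOf* ts) X)
             (rename₂-bodyOf t)))
    (trans (rename₂*-rename₂* _ (∈-++⁺ʳ (aritiesOf t)) (bodyOf* ts))
      (trans (rename₂*-cong-local (bodyOf* ts) λ {_ X} _ →
                lookup-++⁺ʳ (bindingsOf t) (bindingsOf* ts) X)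
             (rename₂*-bodyOf* ts)))

  inline-canonicalise : (t : Term B ℕ) → inline (canonicalise t) ≡ t
  inline-canonicalise = rename₂-bodyOf

  -- `ρ` may identify variables, but the pre-order list of variables tells them apart again. `Xs`
  -- and `Ys` are the parts of that list left for the rest of the traversal.
  rename₂-injective  : (ρ : ∀ {k} → B k → C k) (t u : Term B V) → ∀ {Xs Ys} →
                       rename₂ ρ t ≡ rename₂ ρ u → metas t ++ Xs ≡ metas u ++ Ys →
                       t ≡ u × Xs ≡ Ys
  rename₂*-injective : (ρ : ∀ {k} → B k → C k) (ts us : Vec (Term B V) k) → ∀ {Xs Ys} →
                       rename₂* ρ ts ≡ rename₂* ρ us → metas* ts ++ Xs ≡ metas* us ++ Ys →
                       ts ≡ us × Xs ≡ Ys
  rename₂-injective ρ (var x)     (var .x)    refl eq = refl , eq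
  rename₂-injective ρ (fn f ts)   (fn g us)   r    eq with fn-injective r
  ... | refl , refl , r* = Product.map₁ (cong (fn f)) (rename₂*-injective ρ ts us r* eq)
  rename₂-injective ρ (meta X ts) (meta Y us) r    eq with meta-injective r
  ... | refl , _ , r* with List.∷-injective eq
  ...   | refl , eq* = Product.map₁ (cong (meta X)) (rename₂*-injective ρ ts us r* eq*)
  rename₂*-injective ρ []       []       _ eq = refl , eq
  rename₂*-injective ρ (t ∷ ts) (u ∷ us) r eq =
    let eq′ = trans (sym (List.++-assoc (metas t) _ _)) (trans eq (List.++-assoc (metas u) _ _))
        t≡u , eq″ = rename₂-injective ρ t u (Vec.∷-injectiveˡ r) eq′
        ts≡us , eq‴ = rename₂*-injective ρ ts us (Vec.∷-injectiveʳ r) eq″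
    in cong₂ _∷_ t≡u ts≡us , eq‴

  map-proj₁-allMetas : ∀ Γ → List.map proj₁ (allMetas Γ) ≡ Γ
  map-proj₁-allMetas Γ = trans (map-mapWith∈ Γ _ proj₁) (mapWith∈-id Γ)

  metas-inline : (ς : LetExpr B) →
                 metas (inline ς) ≡ List.map (under (All.lookup (bindings ς))) (allMetas (arities ς))
  metas-inline ς = trans (metas-rename₂ _ (body ς)) (cong (List.map _) (canonical ς))

  arities-inline : (ς : LetExpr B) → List.map proj₁ (metas (inline ς)) ≡ arities ς
  arities-inline ς = trans (cong (List.map proj₁) (metas-inline ς))
    (trans (sym (List.map-∘ (allMetas (arities ς)))) (map-proj₁-allMetas (arities ς)))

  bindings-injective : ∀ {Γ} (bs cs : All B Γ) →
                       List.map (under (All.lookup bs)) (allMetas Γ) ≡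
                       List.map (under (All.lookup cs)) (allMetas Γ) → bs ≡ cs
  bindings-injective {Γ = []}    []       []       _  = refl
  bindings-injective {B} {Γ = k ∷ Γ} (b ∷ bs) (c ∷ cs) eq =
    let eq₀ , eq₁ = List.∷-injective (trans (sym (unfold b bs)) (trans eq (unfold c cs)))
    in cong₂ _∷_ (,-injective eq₀) (bindings-injective bs cs eq₁)
    where
    ,-injective : ∀ {k} {b c : B k} → _≡_ {A = ∃ B} (k , b) (k , c) → b ≡ c
    ,-injective refl = refl
    unfold : ∀ b (bs : All B Γ) → List.map (under (All.lookup (b ∷ bs))) (allMetas (k ∷ Γ)) ≡
                                  (k , b) ∷ List.map (under (All.lookup bs)) (allMetas Γ)
    unfold b bs = trans (cong (List.map (under (All.lookup (b ∷ bs)))) (allMetas-∷ k Γ))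
                        (cong (_ ∷_) (sym (List.map-∘ (allMetas Γ))))

  -- By canonicity, the names in the inlined term, in pre-order, are the bindings in their order;
  -- then these and the order of the variables determine the body. Equations between multisteps can
  -- thus be checked on inlined terms.
  inline-injective : {ς ζ : LetExpr B} → inline ς ≡ inline ζ → ς ≡ ζ
  inline-injective {ς = ς@(letExpr Γ bs M c)} {ζ@(letExpr Δ cs N d)} eq
    with trans (sym (arities-inline ς)) (trans (cong (List.map proj₁ ∘ metas) eq) (arities-inline ζ))
  ... | refl with bindings-injective bs cs
                    (trans (sym (metas-inline ς)) (trans (cong metas eq) (metas-inline ζ)))
  ...   | refl with proj₁ (rename₂-injective _ M N eq (cong (_++ []) (trans c (sym d))))
  ...     | refl = cong (letExpr Γ bs M) (uip c d)

  inline-mapBindings : (f : ∀ {k} → B k → C k) (ς : LetExpr B) →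
                       inline (mapBindings f ς) ≡ rename₂ f (inline ς)
  inline-mapBindings f ς =
    trans (rename₂-cong-local (body ς) λ {_ X} _ → All.lookup-map (bindings ς) X)
          (sym (rename₂-rename₂ f _ (body ς)))

  ⟦⟧-inline : (ς : LetExpr Closed) → ⟦ ς ⟧ ≡ subst₂ id (inline ς)
  ⟦⟧-inline ς = sym (subst₂-rename₂ id _ (body ς))

  ⟦⟧-mapBindings : (f : ∀ {k} → B k → Closed k) (ς : LetExpr B) →
                   ⟦ mapBindings f ς ⟧ ≡ subst₂ f (inline ς)
  ⟦⟧-mapBindings f ς = trans (⟦⟧-inline (mapBindings f ς))
    (trans (cong (subst₂ id) (inline-mapBindings f ς)) (subst₂-rename₂ id f (inline ς)))

  -- Refinement is the pointwise order of decorations.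

  module _ {pat : ∀ {k} → B k → Pattern k} {pat′ : ∀ {k} → C k → Pattern k}
           (σ : ∀ {k} → C k → Term B (Fin k))
           (σ-denotes : ∀ {k} (c : C k) → subst₂ (Pattern.term ∘ pat) (σ c) ≡ Pattern.term (pat′ c))
    where
    -- A name `c` on the coarser side is decorated as one single pattern, which by `⊴-full`
    -- dominates any decoration of the same term, in particular that of `σ c`.
    subst₂-⊴   : (t : Term C V) → mark pat (subst₂ σ t) ⊴ mark pat′ t
    subst₂*-⊴* : (ts : Vec (Term C V) k) → mark* pat (subst₂* σ ts) ⊴* mark* pat′ ts
    subst₂-⊴ (var x)     = var
    subst₂-⊴ (fn f ts)   = fn z≤n (subst₂*-⊴* ts)
    subst₂-⊴ (meta c ts) = ⊴-trans (⊴-reflexive (mark-bind pat _ (σ c))) (bind-mono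
      (λ i → ⊴-trans (⊴-reflexive (sym (lookup-mark* pat (subst₂* σ ts) i)))
                     (lookup-⊴ (subst₂*-⊴* ts) i))
      (⊴-trans (⊴-full (mark-valid pat (σ c)))
               (⊴-reflexive (cong (full 1) (trans (erase-mark pat (σ c)) (σ-denotes c))))))
      where
      lookup-⊴ : ∀ {k} {ms ns : Vec (Deco V) k} → ms ⊴* ns → ∀ i → lookup ms i ⊴ lookup ns i
      lookup-⊴ (r ∷ rs) zero    = r
      lookup-⊴ (r ∷ rs) (suc i) = lookup-⊴ rs i
    subst₂*-⊴* []       = []
    subst₂*-⊴* (t ∷ ts) = subst₂-⊴ t ∷ subst₂*-⊴* ts

  module _ (pat : ∀ {k} → B k → Pattern k) (pat′ : ∀ {k} → C k → Pattern k) where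

    Instance : ∀ {k} → C k → Set
    Instance {k} c = Σ[ t ∈ Term B (Fin k) ] subst₂ (Pattern.term ∘ pat) t ≡ Pattern.term (pat′ c)

    -- The substitution witnessing refinement, stored at the occurrences of the names in u. In this
    -- form it makes sense for arbitrary terms and can be built by induction.
    Refinement : Term B V → Term C V → Set
    Refinement {V} t u = Σ[ v ∈ Term (λ k → Σ[ c ∈ C k ] Instance c) V ]
      rename₂ proj₁ v ≡ u × subst₂ (proj₁ ∘ proj₂) v ≡ t

    Refinement* : Vec (Term B V) k → Vec (Term C V) k → Set
    Refinement* {V} {k} ts us = Σ[ vs ∈ Vec (Term (λ k → Σ[ c ∈ C k ] Instance c) V) k ]
      rename₂* proj₁ vs ≡ us × subst₂* (proj₁ ∘ proj₂) vs ≡ ts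

    -- At a pattern of u, t is cut along that pattern: the part above the cut denotes the pattern,
    -- since comparable decorations have equal erasures, and the pieces are refined in turn. At a
    -- symbol of u outside all patterns, decorated with 0, no pattern of t can start.
    refinement   : (t : Term B V) (u : Term C V) → mark pat t ⊴ mark pat′ u → Refinement t u
    refinement*  : (ts : Vec (Term B V) k) (us : Vec (Term C V) k) →
                   mark* pat ts ⊴* mark* pat′ us → Refinement* ts us
    refinementAt : (us : Vec (Term C V) k) (i : Fin k) (t : Term B V) →
                   mark pat t ⊴ lookup (mark* pat′ us) i → Refinement t (lookup us i)
    refinement (var x)     (var y)   var      = var x , refl , refl
    refinement (meta b ts) (var y)   r with pat b | r
    ... | pattern′ (fn _ _) _ _ | ()
    ... | pattern′ (var _) () _ | _
    refinement (fn f ts)   (fn g us) (fn _ r) =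
      let vs , eq , eq′ = refinement* ts us r in fn f vs , cong (fn f) eq , cong (fn f) eq′
    refinement (meta b ts) (fn g us) r with pat b | r
    ... | pattern′ (fn _ _) _ _ | fn () _
    ... | pattern′ (var _) () _ | _
    refinement {V} t (meta c us) r =
      let p = Pattern.term (pat′ c)
          decomposition top parts eq top⊴ parts⊴ =
            decompose pat {m = full 1 p} {τ = lookup (mark* pat′ us)}
              (trans (vars-full 1 p) (Pattern.canonical (pat′ c)))
              (valid-lookup (mark*-valid* pat′ us)) t r
          vs = λ i → refinementAt us i (parts i) (parts⊴ i)
          inst = c , top , trans (sym (erase-mark pat top))
                                 (trans (⊴⇒erase≡ top⊴) (erase-full 1 p))
          vs* = Vec.tabulate (proj₁ ∘ vs)
      in meta inst vs*
       , cong (meta c) (trans (rename₂*-map proj₁ vs*)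
           (trans (sym (Vec.tabulate-∘ _ (proj₁ ∘ vs)))
                  (trans (Vec.tabulate-cong (proj₁ ∘ proj₂ ∘ vs)) (Vec.tabulate∘lookup us))))
       , trans (bind-cong (λ i → trans (lookup-subst₂* (proj₁ ∘ proj₂) vs* i)
                 (trans (cong (subst₂ (proj₁ ∘ proj₂)) (Vec.lookup∘tabulate (proj₁ ∘ vs) i))
                        (proj₂ (proj₂ (vs i))))) top)
               eq
    refinement* []       []       []       = [] , refl , refl
    refinement* (t ∷ ts) (u ∷ us) (r ∷ rs) =
      let v , eq , eq′ = refinement t u r
          vs , eqs , eqs′ = refinement* ts us rs
      in v ∷ vs , cong₂ _∷_ eq eqs , cong₂ _∷_ eq′ eqs′
    refinementAt (u ∷ us) zero    t r = refinement t u r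
    refinementAt (u ∷ us) (suc i) t r = refinementAt us i t r

  marks : Multipattern → Deco ℕ
  marks ς = mark id (inline ς)

  marks-body : (ς : Multipattern) → marks ς ≡ mark (All.lookup (bindings ς)) (body ς)
  marks-body ς = mark-rename₂ _ (body ς)

  erase-marks : (ς : Multipattern) → erase (marks ς) ≡ ⟦ ς ⟧ₚ
  erase-marks ς = trans (erase-mark id (inline ς)) (sym (⟦⟧-mapBindings Pattern.term ς))

  ⊑⇒⊴ : {ς ζ : Multipattern} → ς ⊑ ζ → marks ς ⊴ marks ζ
  ⊑⇒⊴ {ς} {ζ} (σ , eq , σ-denotes) =
    ⊴-trans (⊴-reflexive (trans (marks-body ς) (cong (mark _) (sym eq))))
            (⊴-trans (subst₂-⊴ σ σ-denotes (body ζ)) (⊴-reflexive (sym (marks-body ζ))))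

  ⊴⇒⊑ : {ς ζ : Multipattern} → marks ς ⊴ marks ζ → ς ⊑ ζ
  ⊴⇒⊑ {ς} {ζ} r =
    let v , eq , eq′ = refinement (All.lookup (bindings ς)) (All.lookup (bindings ζ)) (body ς) (body ζ)
          (⊴-trans (⊴-reflexive (sym (marks-body ς))) (⊴-trans r (⊴-reflexive (marks-body ζ))))
        σ , eq″ = distribute₂ v (trans (cong metas eq) (canonical ζ))
    in (λ Y → proj₁ (σ Y))
     , trans (sym (subst₂-rename₂ (proj₁ ∘ proj₂) (λ Y → Y , σ Y) (body ζ)))
         (trans (cong (subst₂ (proj₁ ∘ proj₂))
                      (sym (trans eq″ (cong (rename₂ (λ Y → Y , σ Y)) eq))))
                eq′)
     , λ Y → proj₂ (σ Y)

  patternSizes : Annotated V → Size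
  patternSizes X = Σₛ (All.reduce (size Fin._≟_ ∘ Pattern.term) (bindingsOf X))

  module _ {V : Set} (_≟_ : DecidableEquality V) where

    size-cong : {t : Term B V} {u : Term C V} → symbols t ≡ symbols u → vars t ≡ vars u →
                size _≟_ t ≡ size _≟_ u
    size-cong {t = t} {u} eq eq′ rewrite eq | eq′ = refl

  bodySize-canonicalise : (X : Annotated ℕ) → bodySize (canonicalise X) ≡ size ℕ._≟_ X
  bodySize-canonicalise X = size-cong ℕ._≟_ {t = bodyOf X} {u = X}
    (trans (sym (symbols-rename₂ _ (bodyOf X))) (cong symbols (rename₂-bodyOf X)))
    (trans (sym (vars-rename₂ _ (bodyOf X))) (cong vars (rename₂-bodyOf X)))

  -- Meets, joins, bottom and top, computed on decorations.

  module _ {t : FO ℕ} where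

    marksOf : MultipatternOf t → Deco ℕ
    marksOf (ς , _) = marks ς

    erase-marksOf : (ς : MultipatternOf t) → erase (marksOf ς) ≡ t
    erase-marksOf (ς , eq) = trans (erase-marks ς) eq

    marksOf-valid : (ς : MultipatternOf t) → Valid 1 (marksOf ς)
    marksOf-valid (ς , _) = mark-valid id (inline ς)

    ≼⇒⊴ : (ς ζ : MultipatternOf t) → ς ≼ ζ → marksOf ς ⊴ marksOf ζ
    ≼⇒⊴ (ς , _) (ζ , _) = ⊑⇒⊴ {ς} {ζ}

    ⊴⇒≼ : (ς ζ : MultipatternOf t) → marksOf ς ⊴ marksOf ζ → ς ≼ ζ
    ⊴⇒≼ (ς , _) (ζ , _) = ⊴⇒⊑ {ς} {ζ}

    asMultipattern : (X : Annotated ℕ) → erase (mark id X) ≡ t →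
                     Σ[ ξ ∈ MultipatternOf t ] marksOf ξ ≡ mark id X × proj₁ ξ ≡ canonicalise X
    asMultipattern X eq =
      (canonicalise X , trans (sym (erase-marks (canonicalise X))) (trans (cong erase eq′) eq))
      , eq′ , refl
      where
      eq′ : marks (canonicalise X) ≡ mark id X
      eq′ = cong (mark id) (inline-canonicalise X)

    module _ (ς ζ : MultipatternOf t) (X : Annotated ℕ) where

      meet-intro : Zip ℕ._⊓_ (marksOf ς) (marksOf ζ) (mark id X) → ς ⋒ ζ ≐ patternSizes X
      meet-intro z =
        let lower = zip-lowerˡ ℕ.m⊓n≤m z
            ξ , eq , eq′ = asMultipattern X (trans (⊴⇒erase≡ lower) (erase-marksOf ς))
            eq≡ = ⊴-reflexive eq
        in ξ
         , ( ⊴⇒≼ ξ ς (⊴-trans eq≡ lower)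
           , ⊴⇒≼ ξ ζ (⊴-trans eq≡ (zip-lowerˡ ℕ.m⊓n≤m (zip-sym ℕ.⊓-comm z)))
           , λ χ χ≼ς χ≼ζ → ⊴⇒≼ χ ξ (⊴-trans
               (zip-greatest ℕ.⊓-glb z (≼⇒⊴ χ ς χ≼ς) (≼⇒⊴ χ ζ χ≼ζ)) (⊴-reflexive (sym eq))))
         , cong patternSize eq′

      join-intro : Zip ℕ._⊔_ (marksOf ς) (marksOf ζ) (mark id X) →
                   Σ[ ξ ∈ MultipatternOf t ] IsJoin ς ζ ξ × marksOf ξ ≡ mark id X ×
                                             bodySize (proj₁ ξ) ≡ size ℕ._≟_ X
      join-intro z =
        let upper = zip-upperˡ ℕ.m≤m⊔n z
            ξ , eq , eq′ = asMultipattern X (trans (sym (⊴⇒erase≡ upper)) (erase-marksOf ς))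
            ≡eq = ⊴-reflexive (sym eq)
        in ξ
         , ( ⊴⇒≼ ς ξ (⊴-trans upper ≡eq)
           , ⊴⇒≼ ζ ξ (⊴-trans (zip-upperˡ ℕ.m≤m⊔n (zip-sym ℕ.⊔-comm z)) ≡eq)
           , λ χ ς≼χ ζ≼χ → ⊴⇒≼ ξ χ (⊴-trans (⊴-reflexive eq)
               (zip-least ℕ.⊔-lub z (≼⇒⊴ ς χ ς≼χ) (≼⇒⊴ ζ χ ζ≼χ))))
         , eq , trans (cong bodySize eq′) (bodySize-canonicalise X)

    bottom-¬overlapping : (ς ζ : MultipatternOf t) → marksOf ς ⊴ bottom t → ¬ Overlapping ς ζ
    bottom-¬overlapping ς ζ r (ξ , (ξ≼ς , _) , ¬bottom) = ¬bottom λ χ → ⊴⇒≼ ξ χ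
      (⊴-trans (≼⇒⊴ ξ ς ξ≼ς) (⊴-trans r
        (⊴-trans (⊴-reflexive (cong bottom (sym (erase-marksOf χ)))) (bottom-least (marksOf χ)))))

    full-isTop : (ξ : MultipatternOf t) → marksOf ξ ≡ full 1 t → IsTop ξ
    full-isTop ξ eq χ = ⊴⇒≼ χ ξ (⊴-trans (⊴-full (marksOf-valid χ))
      (⊴-reflexive (trans (cong (full 1) (erase-marksOf χ)) (sym eq))))

-- Sizes under substitution.

infix 4 _≤ₛ_

-- The componentwise order: it implies the lexicographic one and is the natural order in which sums
-- of sizes are monotone.
_≤ₛ_ : Size → Size → Set
(a , b) ≤ₛ (c , d) = a ≤ c × b ≤ d

≤ₛ⇒≥ₛ : ∀ {p q} → p ≤ₛ q → q ≥ₛ p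
≤ₛ⇒≥ₛ (a≤c , b≤d) with ℕ.m≤n⇒m<n∨m≡n a≤c
... | inj₁ a<c  = [ inj₁ a<c ]
... | inj₂ refl with ℕ.m≤n⇒m<n∨m≡n b≤d
...   | inj₁ b<d  = [ inj₂ (refl , b<d) ]
...   | inj₂ refl = refl

Σₛ-mono : ∀ {ps qs} → ps ⊆ qs → Σₛ ps ≤ₛ Σₛ qs
Σₛ-mono []           = z≤n , z≤n
Σₛ-mono (q ∷ʳ r)     = Product.map (ℕ.m≤n⇒m≤o+n (proj₁ q)) (ℕ.m≤n⇒m≤o+n (proj₂ q)) (Σₛ-mono r)
Σₛ-mono {p ∷ _} (refl ∷ r) =
  Product.map (ℕ.+-monoʳ-≤ (proj₁ p)) (ℕ.+-monoʳ-≤ (proj₂ p)) (Σₛ-mono r)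

module Sizes (Sym : ℕ → Set) where
  open Rewriting Sym
  open TermLemmas Sym
  open Decorations Sym using (Annotated)
  open Lets Sym using (patternSizes)

  private variable
    𝒳 B : ℕ → Set
    V W : Set
    k : ℕ

  symbols-bind-var   : (f : V → W) (t : Term 𝒳 V) → symbols (bind (var ∘ f) t) ≡ symbols t
  symbols*-bind*-var : (f : V → W) (ts : Vec (Term 𝒳 V) k) →
                       symbols* (bind* (var ∘ f) ts) ≡ symbols* ts
  symbols-bind-var f (var x)     = refl
  symbols-bind-var f (fn g ts)   = cong suc (symbols*-bind*-var f ts)
  symbols-bind-var f (meta X ts) = cong suc (symbols*-bind*-var f ts)
  symbols*-bind*-var f []       = refl
  symbols*-bind*-var f (t ∷ ts) = cong₂ _+_ (symbols-bind-var f t) (symbols*-bind*-var f ts)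

  module _ (σ : V → Term 𝒳 W) where

    symbols-bind-≥   : ∀ t → symbols t ≤ symbols (bind σ t)
    symbols*-bind*-≥ : (ts : Vec _ k) → symbols* ts ≤ symbols* (bind* σ ts)
    symbols-bind-≥ (var x)     = z≤n
    symbols-bind-≥ (fn f ts)   = s≤s (symbols*-bind*-≥ ts)
    symbols-bind-≥ (meta X ts) = s≤s (symbols*-bind*-≥ ts)
    symbols*-bind*-≥ []       = z≤n
    symbols*-bind*-≥ (t ∷ ts) = ℕ.+-mono-≤ (symbols-bind-≥ t) (symbols*-bind*-≥ ts)

    symbols-bind-+   : ∀ t {x} → x ∈ vars t → symbols t + symbols (σ x) ≤ symbols (bind σ t)
    symbols*-bind*-+ : (ts : Vec _ k) → ∀ {x} → x ∈ vars* ts →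
                       symbols* ts + symbols (σ x) ≤ symbols* (bind* σ ts)
    symbols-bind-+ (var x)     (here refl) = ℕ.≤-refl
    symbols-bind-+ (fn f ts)   x∈          = s≤s (symbols*-bind*-+ ts x∈)
    symbols-bind-+ (meta X ts) x∈          = s≤s (symbols*-bind*-+ ts x∈)
    symbols*-bind*-+ (t ∷ ts) {x} x∈ with ∈-++⁻ (vars t) x∈
    ... | inj₂ x∈ts = ℕ.≤-trans (ℕ.≤-reflexive (ℕ.+-assoc (symbols t) _ _))
                                (ℕ.+-mono-≤ (symbols-bind-≥ t) (symbols*-bind*-+ ts x∈ts))
    ... | inj₁ x∈t  = begin
      symbols t + symbols* ts + symbols (σ x)   ≡⟨ ℕ.+-assoc (symbols t) _ _ ⟩
      symbols t + (symbols* ts + symbols (σ x)) ≡⟨ cong (symbols t +_) (ℕ.+-comm (symbols* ts) _) ⟩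
      symbols t + (symbols (σ x) + symbols* ts) ≡⟨ ℕ.+-assoc (symbols t) _ _ ⟨
      symbols t + symbols (σ x) + symbols* ts
        ≤⟨ ℕ.+-mono-≤ (symbols-bind-+ t x∈t) (symbols*-bind*-≥ ts) ⟩
      symbols (bind σ t) + symbols* (bind* σ ts) ∎
      where open ℕ.≤-Reasoning

    metas-bind-⊇   : ∀ t → metas t ⊆ metas (bind σ t)
    metas*-bind*-⊇ : (ts : Vec _ k) → metas* ts ⊆ metas* (bind* σ ts)
    metas-bind-⊇ (var x)     = minimum _
    metas-bind-⊇ (fn f ts)   = metas*-bind*-⊇ ts
    metas-bind-⊇ (meta X ts) = refl ∷ metas*-bind*-⊇ ts
    metas*-bind*-⊇ []       = []
    metas*-bind*-⊇ (t ∷ ts) = Sublist.++⁺ (metas-bind-⊇ t) (metas*-bind*-⊇ ts)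

    metas-bind-⊇-var   : ∀ t {x} → x ∈ vars t → metas (σ x) ⊆ metas (bind σ t)
    metas*-bind*-⊇-var : (ts : Vec _ k) → ∀ {x} → x ∈ vars* ts → metas (σ x) ⊆ metas* (bind* σ ts)
    metas-bind-⊇-var (var x)     (here refl) = ⊆-refl
    metas-bind-⊇-var (fn f ts)   x∈          = metas*-bind*-⊇-var ts x∈
    metas-bind-⊇-var (meta X ts) x∈          = _ ∷ʳ metas*-bind*-⊇-var ts x∈
    metas*-bind*-⊇-var (t ∷ ts) x∈ with ∈-++⁻ (vars t) x∈
    ... | inj₁ x∈t  = Sublist.++⁺ʳ _ (metas-bind-⊇-var t x∈t)
    ... | inj₂ x∈ts = Sublist.++⁺ˡ (metas (bind σ t)) (metas*-bind*-⊇-var ts x∈ts)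

  metas-bind-var   : (f : V → W) (t : Term 𝒳 V) → metas (bind (var ∘ f) t) ≡ metas t
  metas*-bind*-var : (f : V → W) (ts : Vec (Term 𝒳 V) k) → metas* (bind* (var ∘ f) ts) ≡ metas* ts
  metas-bind-var f (var x)     = refl
  metas-bind-var f (fn g ts)   = metas*-bind*-var f ts
  metas-bind-var f (meta X ts) = cong (_ ∷_) (metas*-bind*-var f ts)
  metas*-bind*-var f []       = refl
  metas*-bind*-var f (t ∷ ts) = cong₂ _++_ (metas-bind-var f t) (metas*-bind*-var f ts)

  module _ {A : Set} (f : ∀ {k} → B k → A) where

    reduce-++⁺ : ∀ {Γ Δ} (bs : All B Γ) (cs : All B Δ) →
                 All.reduce f (All.++⁺ bs cs) ≡ All.reduce f bs ++ All.reduce f cs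
    reduce-++⁺ []       cs = refl
    reduce-++⁺ (b ∷ bs) cs = cong (f b ∷_) (reduce-++⁺ bs cs)

    reduce-bindingsOf   : (t : Term B V) →
                          All.reduce f (bindingsOf t) ≡ List.map (λ b → f (proj₂ b)) (metas t)
    reduce-bindingsOf*  : (ts : Vec (Term B V) k) →
                          All.reduce f (bindingsOf* ts) ≡ List.map (λ b → f (proj₂ b)) (metas* ts)
    reduce-bindingsOf (var x)     = refl
    reduce-bindingsOf (fn g ts)   = reduce-bindingsOf* ts
    reduce-bindingsOf (meta b ts) = cong (f b ∷_) (reduce-bindingsOf* ts)
    reduce-bindingsOf* []       = refl
    reduce-bindingsOf* (t ∷ ts) =
      trans (reduce-++⁺ (bindingsOf t) (bindingsOf* ts))
        (trans (cong₂ _++_ (reduce-bindingsOf t) (reduce-bindingsOf* ts))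
               (sym (List.map-++ _ (metas t) (metas* ts))))

  -- Pattern-size depends only on the list of patterns, and substitution keeps those of the context
  -- as well as those of what is plugged in. This bounds the overlap of the pieces of a peak.
  patternSizes-mono : {t : Annotated V} {u : Annotated W} → metas t ⊆ metas u →
                      patternSizes t ≤ₛ patternSizes u
  patternSizes-mono {t = t} {u} r
    rewrite reduce-bindingsOf (size Fin._≟_ ∘ Pattern.term) t
          | reduce-bindingsOf (size Fin._≟_ ∘ Pattern.term) u = Σₛ-mono (Sublist.map⁺ _ r)

  renaming⊎symbol : (ts : Vec (Term 𝒳 V) k) →
                    (Σ[ f ∈ (Fin k → V) ] ∀ i → lookup ts i ≡ var (f i)) ⊎
                    (∃[ i ] 1 ≤ symbols (lookup ts i))
  renaming⊎symbol []       = inj₁ ((λ ()) , λ ())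
  renaming⊎symbol (fn f us ∷ ts)   = inj₂ (zero , s≤s z≤n)
  renaming⊎symbol (meta X us ∷ ts) = inj₂ (zero , s≤s z≤n)
  renaming⊎symbol (var x ∷ ts) with renaming⊎symbol ts
  ... | inj₁ (f , eq) = inj₁ ((λ { zero → x ; (suc i) → f i }) , λ { zero → refl ; (suc i) → eq i })
  ... | inj₂ (i , 1≤) = inj₂ (suc i , 1≤)

-- Peaks of multisteps and their vertical decomposition.

module Peaks (Sym : ℕ → Set) (R : Rewriting.TRS Sym) (leftLinear : Rewriting.LeftLinear Sym R) where
  open Rewriting Sym
  open Steps R leftLinear
  open TRS R
  open TermLemmas Sym
  open Decorations Sym
  open Lets Sym
  open Sizes Sym
  open Counting ℕ._≟_
  open Marking {Rule} lhsPattern hiding (mark*) renaming (mark to markᵣ)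
  open Marking {Pattern} id using (mark; mark*)

  private variable
    V : Set

  marks-src : (Φ : Multistep R) → marks (src Φ) ≡ markᵣ (inline Φ)
  marks-src Φ = trans (cong mark (inline-mapBindings lhsPattern Φ))
                      (mark-rename₂ {pat = id} lhsPattern (inline Φ))

  ⟦src⟧ : (Φ : Multistep R) → ⟦ src Φ ⟧ₚ ≡ subst₂ lhs (inline Φ)
  ⟦src⟧ Φ = trans (sym (erase-marks (src Φ)))
    (trans (cong erase (marks-src Φ)) (erase-mark (inline Φ)))

  ⟦tgt⟧ : (Φ : Multistep R) → ⟦ tgt Φ ⟧ ≡ subst₂ rhs (inline Φ)
  ⟦tgt⟧ = ⟦⟧-mapBindings rhs

  peakOf : (A B : Term Rule ℕ) → erase (markᵣ A) ≡ erase (markᵣ B) → Peak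
  peakOf A B eq = peak {s = subst₂ rhs A} {subst₂ lhs A} {subst₂ rhs B}
    (canonicalise A) (canonicalise B)
    (source A , target A)
    (trans (source B) (trans (sym (erase-mark B)) (trans (sym eq) (erase-mark A))) , target B)
    where
    source : ∀ C → ⟦ src (canonicalise C) ⟧ₚ ≡ subst₂ lhs C
    source C = trans (⟦src⟧ (canonicalise C)) (cong (subst₂ lhs) (inline-canonicalise C))
    target : ∀ C → ⟦ tgt (canonicalise C) ⟧ ≡ subst₂ rhs C
    target C = trans (⟦tgt⟧ (canonicalise C)) (cong (subst₂ rhs) (inline-canonicalise C))

  module _ (P : Peak) where
    open Peak P

    erase-peak : erase (markᵣ (inline Φ)) ≡ t × erase (markᵣ (inline Ψ)) ≡ t
    erase-peak = trans (cong erase (sym (marks-src Φ))) (erase-marksOf srcΦ)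
               , trans (cong erase (sym (marks-src Ψ))) (erase-marksOf srcΨ)

    peak-zip : ∀ {op m} → Zip op (markᵣ (inline Φ)) (markᵣ (inline Ψ)) m →
               Zip op (marksOf srcΦ) (marksOf srcΨ) m
    peak-zip z rewrite marks-src Φ | marks-src Ψ = z

    peak-meet : ∀ {X} → Zip ℕ._⊓_ (markᵣ (inline Φ)) (markᵣ (inline Ψ)) (mark X) →
                srcΦ ⋒ srcΨ ≐ patternSizes X
    peak-meet {X} z = meet-intro srcΦ srcΨ X (peak-zip z)

    peak-join : ∀ {X} → Zip ℕ._⊔_ (markᵣ (inline Φ)) (markᵣ (inline Ψ)) (mark X) →
                srcΦ ⋓ srcΨ ≐ size ℕ._≟_ X
    peak-join {X} z =
      let ξ , ξ-join , _ , eq = join-intro srcΦ srcΨ X (peak-zip z) in ξ , ξ-join , eq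

  peakOf-zip : ∀ A B eq {op m} → Zip op (markᵣ A) (markᵣ B) m →
               Zip op (markᵣ (inline (Peak.Φ (peakOf A B eq))))
                      (markᵣ (inline (Peak.Ψ (peakOf A B eq)))) m
  peakOf-zip A B eq z rewrite inline-canonicalise A | inline-canonicalise B = z

  meetOf : (A B : Term Rule V) → erase (markᵣ A) ≡ erase (markᵣ B) →
           Σ[ X ∈ Annotated V ] Zip ℕ._⊓_ (markᵣ A) (markᵣ B) (mark X)
  meetOf A B eq =
    let m , z = zip-exists (markᵣ A) (markᵣ B) eq
    in to m , subst (Zip ℕ._⊓_ (markᵣ A) (markᵣ B))
                    (sym (mark-to (meet-valid z (mark-valid A) (mark-valid B)))) z

  joinOf : (A B : Term Rule V) → erase (markᵣ A) ≡ erase (markᵣ B) →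
           Σ[ X ∈ Annotated V ] Zip ℕ._⊔_ (markᵣ A) (markᵣ B) (mark X)
  joinOf A B eq =
    let m , z = zip-exists (markᵣ A) (markᵣ B) eq
    in to m , subst (Zip ℕ._⊔_ (markᵣ A) (markᵣ B))
                    (sym (mark-to (join-valid z (mark-valid A) (mark-valid B)))) z

  Decomposable : Peak → Set
  Decomposable P =
    ∃[ n ] Σ[ xs ∈ Vec ℕ n ] Σ[ P₀ ∈ Peak ] Σ[ Ps ∈ Vec Peak n ]
      (Unique xs
      × Φ P ≡ Φ P₀ [ xs ≔ₗ map Φ Ps ]
      × Ψ P ≡ Ψ P₀ [ xs ≔ₗ map Ψ Ps ]
      × s P ≡ s P₀ [ xs ≔ₜ map s Ps ]
      × t P ≡ t P₀ [ xs ≔ₜ map t Ps ]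
      × u P ≡ u P₀ [ xs ≔ₜ map u Ps ]
      × ((i : Fin (suc n)) →
          P ⋒≥ lookup (P₀ ∷ Ps) i × P ⋓> lookup (P₀ ∷ Ps) i))
    where open Peak

  -- Names for the holes. The part above the cut has no other variables and substitution is
  -- simultaneous, so a clash with variables of the pieces is harmless.
  indices : ∀ n → Vec ℕ n
  indices n = Vec.tabulate toℕ

  indices-unique : ∀ n → Unique (indices n)
  indices-unique n = VecUnique.tabulate⁺ Fin.toℕ-injective

  module _ {𝒳 : ℕ → Set} where

    ≔-lookup : ∀ {n} {xs : Vec ℕ n} → Unique xs → (ts : Vec (Term 𝒳 ℕ) n) →
               ∀ i → (xs ≔ ts) (lookup xs i) ≡ lookup ts i
    ≔-lookup {xs = x ∷ xs} (_ VecAllPairs.∷ _) (t ∷ ts) zero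
      rewrite dec-true (x ℕ.≟ x) refl = refl
    ≔-lookup {xs = x ∷ xs} (x∉ VecAllPairs.∷ xs!) (t ∷ ts) (suc i)
      rewrite dec-false (lookup xs i ℕ.≟ x) (VecAll.lookup⁺ x∉ i ∘ sym) = ≔-lookup xs! ts i

    instantiate-indices : ∀ {n} {A : Set} (t : Term 𝒳 (Fin n)) (f : A → Term 𝒳 ℕ) (g : Fin n → A) →
      bind (var ∘ toℕ) t [ indices n ≔ₜ map f (Vec.tabulate g) ] ≡ bind (f ∘ g) t
    instantiate-indices {n} t f g = trans (bind-bind _ _ t) (bind-cong (λ i → begin
      (indices n ≔ map f (Vec.tabulate g)) (toℕ i)
        ≡⟨ cong (indices n ≔ _) (Vec.lookup∘tabulate toℕ i) ⟨
      (indices n ≔ map f (Vec.tabulate g)) (lookup (indices n) i)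
        ≡⟨ ≔-lookup (indices-unique n) _ i ⟩
      lookup (map f (Vec.tabulate g)) i  ≡⟨ Vec.lookup-map i f (Vec.tabulate g) ⟩
      f (lookup (Vec.tabulate g) i)      ≡⟨ cong f (Vec.lookup∘tabulate g i) ⟩
      f (g i)                            ∎) t)
      where open ≡-Reasoning

  -- With `σ` being `lhs` or `rhs`: as the two kinds of substitution commute, s, t and u decompose
  -- along with the multisteps.
  subst₂-cut : ∀ {n} (σ : ∀ {k} → Rule k → FO (Fin k)) (A : Term Rule (Fin n))
               (As : Fin n → Term Rule ℕ) {B : Set} (f : B → FO ℕ) (g : Fin n → B) → (∀ i → f (g i) ≡ subst₂ σ (As i)) →
               subst₂ σ (bind As A) ≡
               subst₂ σ (bind (var ∘ toℕ) A) [ indices n ≔ₜ map f (Vec.tabulate g) ]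
  subst₂-cut {n} σ A As f g eq = begin
    subst₂ σ (bind As A)                  ≡⟨ subst₂-bind σ As A ⟩
    bind (subst₂ σ ∘ As) (subst₂ σ A)     ≡⟨ bind-cong eq (subst₂ σ A) ⟨
    bind (f ∘ g) (subst₂ σ A)             ≡⟨ instantiate-indices (subst₂ σ A) f g ⟨
    bind (var ∘ toℕ) (subst₂ σ A) [ indices n ≔ₜ map f (Vec.tabulate g) ]
      ≡⟨ cong _[ indices n ≔ₜ map f (Vec.tabulate g) ] (subst₂-bind σ (var ∘ toℕ) A) ⟨
    subst₂ σ (bind (var ∘ toℕ) A) [ indices n ≔ₜ map f (Vec.tabulate g) ] ∎
    where open ≡-Reasoning

  inline-cut : ∀ {n} (Φ : Multistep R) (A : Term Rule (Fin n)) (As : Fin n → Term Rule ℕ) →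
               bind As A ≡ inline Φ → {B : Set} (f : B → Multistep R) (g : Fin n → B) →
               (∀ i → f (g i) ≡ canonicalise (As i)) →
               Φ ≡ canonicalise (bind (var ∘ toℕ) A) [ indices n ≔ₗ map f (Vec.tabulate g) ]
  inline-cut {n} Φ A As eq f g eq′ = inline-injective (begin
    inline Φ                                ≡⟨ eq ⟨
    bind As A
      ≡⟨ bind-cong (λ i → trans (cong inline (eq′ i)) (inline-canonicalise (As i))) A ⟨
    bind (inline ∘ f ∘ g) A                 ≡⟨ instantiate-indices A (inline ∘ f) g ⟨
    A′ [ indices n ≔ₜ map (inline ∘ f) (Vec.tabulate g) ]
      ≡⟨ cong (A′ [ indices n ≔ₜ_]) (Vec.map-∘ inline f (Vec.tabulate g)) ⟩
    A′ [ indices n ≔ₜ map inline (map f (Vec.tabulate g)) ]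
      ≡⟨ cong _[ indices n ≔ₜ map inline (map f (Vec.tabulate g)) ] (inline-canonicalise A′) ⟨
    inline (canonicalise A′) [ indices n ≔ₜ map inline (map f (Vec.tabulate g)) ]
      ≡⟨ inline-canonicalise _ ⟨
    inline (canonicalise A′ [ indices n ≔ₗ map f (Vec.tabulate g) ]) ∎)
    where
    open ≡-Reasoning
    A′ = bind (var ∘ toℕ) A

  -- Cutting both sides of a peak along a layer of its join.

  module _ (P : Peak) {n : ℕ} (h : Annotated (Fin n)) (Zs : Fin n → Annotated ℕ)
           (h-linear : vars h ≡ allFin n) (h-symbols : 1 ≤ symbols h)
           (z : Zip ℕ._⊔_ (markᵣ (inline (Peak.Φ P))) (markᵣ (inline (Peak.Ψ P))) (mark (bind Zs h)))
           (h-smaller : size ℕ._≟_ (bind Zs h) >ₛ size ℕ._≟_ (bind (var ∘ toℕ) h))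
           (a : Decomposition (inline (Peak.Φ P)) (mark h) (mark ∘ Zs))
           (b : Decomposition (inline (Peak.Ψ P)) (mark h) (mark ∘ Zs)) where

    private
      open Decomposition

      top-eq : erase (markᵣ (top a)) ≡ erase (markᵣ (top b))
      top-eq = trans (⊴⇒erase≡ (top⊴ a)) (sym (⊴⇒erase≡ (top⊴ b)))

      parts-eq : ∀ i → erase (markᵣ (parts a i)) ≡ erase (markᵣ (parts b i))
      parts-eq i = trans (⊴⇒erase≡ (parts⊴ a i)) (sym (⊴⇒erase≡ (parts⊴ b i)))

      mark-cut : ∀ {C} (c : Decomposition C (mark h) (mark ∘ Zs)) →
                 markᵣ C ≡ D.bind (markᵣ ∘ parts c) (markᵣ (top c))
      mark-cut c = trans (cong markᵣ (sym (restore c))) (mark-bind (parts c) (top c))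

      var-zip : ∀ {op} (i : Fin n) → Zip op (D.var (toℕ i)) (D.var (toℕ i)) (D.var (toℕ i))
      var-zip i = var

      -- The join of P is already presented as `Zs` plugged into `h`, and both multisteps are cut
      -- along `h`. Separating it yields the joins of the pieces.
      joins : Zip ℕ._⊔_ (markᵣ (top a)) (markᵣ (top b)) (mark h) ×
              (∀ {i} → i ∈ D.vars (mark h) →
                Zip ℕ._⊔_ (markᵣ (parts a i)) (markᵣ (parts b i)) (mark (Zs i)))
      joins = zip-unbind (top⊴ a) (top⊴ b)
                (zip-resp (mark-cut a) (mark-cut b) (Marking.mark-bind id Zs h) z)

      X₀ = proj₁ (meetOf (top a) (top b) top-eq)
      Xs = λ i → proj₁ (meetOf (parts a i) (parts b i) (parts-eq i))

      meet₀ : Zip ℕ._⊓_ (markᵣ (top a)) (markᵣ (top b)) (mark X₀)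
      meet₀ = proj₂ (meetOf (top a) (top b) top-eq)

      meets : ∀ i → Zip ℕ._⊓_ (markᵣ (parts a i)) (markᵣ (parts b i)) (mark (Xs i))
      meets i = proj₂ (meetOf (parts a i) (parts b i) (parts-eq i))

      -- In the opposite direction to `joins`: the meet of P is assembled from those of the pieces,
      -- which exhibits their patterns inside it.
      meet : Zip ℕ._⊓_ (markᵣ (inline (Peak.Φ P))) (markᵣ (inline (Peak.Ψ P))) (mark (bind Xs X₀))
      meet = zip-resp (sym (mark-cut a)) (sym (mark-cut b)) (sym (Marking.mark-bind id Xs X₀))
        (zip-bind meets meet₀)

      rename-zip : ∀ {op X} → Zip op (markᵣ (top a)) (markᵣ (top b)) (mark X) →
                   Zip op (markᵣ (bind (var ∘ toℕ) (top a))) (markᵣ (bind (var ∘ toℕ) (top b)))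
                          (mark (bind (var ∘ toℕ) X))
      rename-zip {X = X} z = zip-resp (sym (mark-bind _ (top a))) (sym (mark-bind _ (top b)))
        (sym (Marking.mark-bind id (var ∘ toℕ) X)) (zip-bind var-zip z)

      rename-eq : erase (markᵣ (bind (var ∘ toℕ) (top a))) ≡ erase (markᵣ (bind (var ∘ toℕ) (top b)))
      rename-eq = trans (erase-rename (top a))
                        (trans (cong (bind (var ∘ toℕ)) top-eq) (sym (erase-rename (top b))))
        where
        erase-rename : ∀ C → erase (markᵣ (bind (var ∘ toℕ) C)) ≡ bind (var ∘ toℕ) (erase (markᵣ C))
        erase-rename C = trans (cong erase (mark-bind (var ∘ toℕ) C)) (erase-bind _ (markᵣ C))

      P₀ : Peak
      P₀ = peakOf (bind (var ∘ toℕ) (top a)) (bind (var ∘ toℕ) (top b)) rename-eq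

      top-zip = peakOf-zip (bind (var ∘ toℕ) (top a)) (bind (var ∘ toℕ) (top b)) rename-eq

      Pᵢ : Fin n → Peak
      Pᵢ i = peakOf (parts a i) (parts b i) (parts-eq i)

      -- Ensures that `Xs i` really occurs in `bind Xs X₀`.
      i∈X₀ : ∀ i → i ∈ vars X₀
      i∈X₀ i = subst (i ∈_) (sym eq) (∈-allFin i)
        where
        eq : vars X₀ ≡ allFin n
        eq = trans (sym (Marking.vars-mark id X₀))
          (trans (⊴⇒vars≡ (⊴-trans (zip-lowerˡ ℕ.m⊓n≤m meet₀) (top⊴ a)))
                 (trans (Marking.vars-mark id h) h-linear))

      smaller₀ : P ⋒≥ P₀ × P ⋓> P₀
      smaller₀ =
        ( _ , _ , peak-meet P {bind Xs X₀} meet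
        , peak-meet P₀ {bind (var ∘ toℕ) X₀}
            (top-zip (rename-zip {X = X₀} meet₀))
        , ≤ₛ⇒≥ₛ (patternSizes-mono {t = bind (var ∘ toℕ) X₀} {bind Xs X₀}
            (subst (_⊆ metas (bind Xs X₀)) (sym (metas-bind-var toℕ X₀)) (metas-bind-⊇ Xs X₀)))) ,
        ( _ , _ , peak-join P {bind Zs h} z
        , peak-join P₀ {bind (var ∘ toℕ) h} (top-zip (rename-zip {X = h} (proj₁ joins)))
        , h-smaller)

      smallerᵢ : ∀ i → P ⋒≥ Pᵢ i × P ⋓> Pᵢ i
      smallerᵢ i =
        ( _ , _ , peak-meet P {bind Xs X₀} meet
        , peak-meet (Pᵢ i) {Xs i}
            (peakOf-zip (parts a i) (parts b i) (parts-eq i) (meets i))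
        , ≤ₛ⇒≥ₛ (patternSizes-mono {t = Xs i} {bind Xs X₀} (metas-bind-⊇-var Xs X₀ (i∈X₀ i)))) ,
        ( _ , _ , peak-join P {bind Zs h} z
        , peak-join (Pᵢ i) {Zs i} (peakOf-zip (parts a i) (parts b i) (parts-eq i)
            (proj₂ joins (subst (i ∈_) (sym (trans (Marking.vars-mark id h) h-linear)) (∈-allFin i))))
        -- The symbol of `h` counts for P but not for the piece below it.
        , inj₁ (ℕ.≤-trans (ℕ.+-monoˡ-≤ (symbols (Zs i)) h-symbols)
                          (symbols-bind-+ Zs h (subst (i ∈_) (sym h-linear) (∈-allFin i)))))

      smaller : ∀ i → P ⋒≥ lookup (P₀ ∷ Vec.tabulate Pᵢ) i × P ⋓> lookup (P₀ ∷ Vec.tabulate Pᵢ) i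
      smaller zero    = smaller₀
      smaller (suc i) = subst (λ Q → P ⋒≥ Q × P ⋓> Q) (sym (Vec.lookup∘tabulate Pᵢ i)) (smallerᵢ i)

    decomposable-along : Decomposable P
    decomposable-along = n , indices n , P₀ , Vec.tabulate Pᵢ , indices-unique n
      , inline-cut (Peak.Φ P) (top a) (parts a) (restore a) Peak.Φ Pᵢ (λ _ → refl)
      , inline-cut (Peak.Ψ P) (top b) (parts b) (restore b) Peak.Ψ Pᵢ (λ _ → refl)
      , trans (trans (sym (proj₂ (Peak.Φ∶t⊸s P))) (⟦tgt⟧ (Peak.Φ P)))
          (trans (cong (subst₂ rhs) (sym (restore a)))
                 (subst₂-cut rhs (top a) (parts a) Peak.s Pᵢ (λ _ → refl)))
      , trans (trans (sym (proj₁ (Peak.Φ∶t⊸s P))) (⟦src⟧ (Peak.Φ P)))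
          (trans (cong (subst₂ lhs) (sym (restore a)))
                 (subst₂-cut lhs (top a) (parts a) Peak.t Pᵢ (λ _ → refl)))
      , trans (trans (sym (proj₂ (Peak.Ψ∶t⊸u P))) (⟦tgt⟧ (Peak.Ψ P)))
          (trans (cong (subst₂ rhs) (sym (restore b)))
                 (subst₂-cut rhs (top b) (parts b) Peak.u Pᵢ (λ _ → refl)))
      , smaller

  decomposable : (P : Peak) {n : ℕ} (h : Annotated (Fin n)) (Zs : Fin n → Annotated ℕ) →
    vars h ≡ allFin n → 1 ≤ symbols h →
    Zip ℕ._⊔_ (markᵣ (inline (Peak.Φ P))) (markᵣ (inline (Peak.Ψ P))) (mark (bind Zs h)) →
    size ℕ._≟_ (bind Zs h) >ₛ size ℕ._≟_ (bind (var ∘ toℕ) h) → Decomposable P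
  decomposable P h Zs h-linear h-symbols z h-smaller =
    decomposable-along P h Zs h-linear h-symbols z h-smaller
      (cut-along (inline (Peak.Φ P)) (zip-upperˡ ℕ.m≤m⊔n z))
      (cut-along (inline (Peak.Ψ P)) (zip-upperˡ ℕ.m≤m⊔n (zip-sym ℕ.⊔-comm z)))
    where
    cut-along : (C : Term Rule ℕ) → markᵣ C ⊴ mark (bind Zs h) → Decomposition C (mark h) (mark ∘ Zs)
    cut-along C r = decompose (trans (Marking.vars-mark id h) h-linear) (Marking.mark-valid id ∘ Zs) C
      (⊴-trans r (⊴-reflexive (Marking.mark-bind id Zs h)))

  -- Case analysis on the topmost layer of the join.

  module _ {𝒳 : ℕ → Set} {n} (h : Term 𝒳 (Fin n)) (Zs : Fin n → Term 𝒳 ℕ)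
           (h-linear : vars h ≡ allFin n) where

    symbol⇒smaller : ∀ i → 1 ≤ symbols (Zs i) →
                     size ℕ._≟_ (bind Zs h) >ₛ size ℕ._≟_ (bind (var ∘ toℕ) h)
    symbol⇒smaller i 1≤ = inj₁ (begin-strict
      symbols (bind (var ∘ toℕ) h) ≡⟨ symbols-bind-var toℕ h ⟩
      symbols h                    <⟨ ℕ.m<m+n (symbols h) 1≤ ⟩
      symbols h + symbols (Zs i)   ≤⟨ symbols-bind-+ Zs h (subst (i ∈_) (sym h-linear) (∈-allFin i)) ⟩
      symbols (bind Zs h)          ∎)
      where open ℕ.≤-Reasoning

    -- Both terms have the same number of symbols and of variable occurrences. Distinct variables
    -- keep the sum of squares down to the number of occurrences, which a repeated variable exceeds.
    duplicate⇒smaller : (f : Fin n → ℕ) → Zs ≗ var ∘ f →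
                        ∀ {x} → x ∈ vars (bind Zs h) → 1 < count x (vars (bind Zs h)) →
                        size ℕ._≟_ (bind Zs h) >ₛ size ℕ._≟_ (bind (var ∘ toℕ) h)
    duplicate⇒smaller f eq x∈ 1<
      rewrite bind-cong eq h = inj₂
        ( trans (symbols-bind-var f h) (sym (symbols-bind-var toℕ h))
        , (begin-strict
            squares (vars (bind (var ∘ toℕ) h))     ≡⟨ cong squares (vars-bind-var toℕ h) ⟩
            squares (List.map toℕ (vars h))         ≤⟨ squares-unique (map⁺ Fin.toℕ-injective
                                                         (subst ListUnique.Unique (sym h-linear) (allFin⁺ n))) ⟩
            List.length (List.map toℕ (vars h))     ≡⟨ List.length-map toℕ (vars h) ⟩
            List.length (vars h)                    ≡⟨ List.length-map f (vars h) ⟨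
            List.length (List.map f (vars h))       ≡⟨ cong List.length (vars-bind-var f h) ⟨
            List.length (vars (bind (var ∘ f) h))   <⟨ squares-duplicate x∈ 1< ⟩
            squares (vars (bind (var ∘ f) h))       ∎))
      where open ℕ.≤-Reasoning

  mark*-renaming : ∀ {k} (ts : Vec (Annotated V) k) {f : Fin k → V} → (∀ i → lookup ts i ≡ var (f i)) →
                   mark* ts ⊴* bottom* (erase* (mark* ts))
  mark*-renaming []       eq = []
  mark*-renaming (t ∷ ts) eq rewrite eq zero = var ∷ mark*-renaming ts (eq ∘ suc)

  -- Plugging variables into a pattern merely renames it, and `full` commutes with renaming.
  mark-renamed-pattern : ∀ {k} (p : Pattern k) (ts : Vec (Annotated V) k) {f : Fin k → V} →
                         (∀ i → lookup ts i ≡ var (f i)) →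
                         mark (meta p ts) ≡ full 1 (erase (mark (meta p ts)))
  mark-renamed-pattern p ts {f} eq = trans eq′ (cong (full 1)
    (sym (trans (cong erase eq′) (erase-full 1 (bind (var ∘ f) (Pattern.term p))))))
    where
    eq′ : mark (meta p ts) ≡ full 1 (bind (var ∘ f) (Pattern.term p))
    eq′ = trans (DL.bind-cong (λ i → trans (Marking.lookup-mark* id ts i) (cong mark (eq i)))
                              (full 1 (Pattern.term p)))
                (sym (full-rename f 1 (Pattern.term p)))

  critical⊎decomposable : (P : Peak) → OverlappingPeak P → CriticalPeak P ⊎ Decomposable P
  critical⊎decomposable P overlapping =
    let e , e′ = erase-peak P
        ζ , z = joinOf (inline Φ) (inline Ψ) (trans e (sym e′))
    in analyse ζ z
    where
    open Peak P

    Join : Annotated ℕ → Set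
    Join ζ = Zip ℕ._⊔_ (markᵣ (inline Φ)) (markᵣ (inline Ψ)) (mark ζ)

    erase-join : ∀ {ζ} → Join ζ → erase (mark ζ) ≡ t
    erase-join z = trans (sym (⊴⇒erase≡ (zip-upperˡ ℕ.m≤m⊔n z))) (proj₁ (erase-peak P))

    -- If even the join were the bottom, so would be the source multipattern of Φ and with it the
    -- meet, against the overlap.
    ¬bottom : ∀ {ζ} → Join ζ → ¬ mark ζ ⊴ bottom (erase (mark ζ))
    ¬bottom {ζ} z r = bottom-¬overlapping srcΦ srcΨ
      (⊴-trans (zip-upperˡ ℕ.m≤m⊔n (peak-zip P z))
               (⊴-trans r (⊴-reflexive (cong bottom (erase-join {ζ} z))))) overlapping

    -- There are two ways for the body-size to drop when `h` is split off: some argument contains a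
    -- symbol, or some variable is repeated. Only if both fail is there nothing to decompose here.
    layer : ∀ {k ζ} (h : Annotated (Fin k)) (Zs : Vec (Annotated ℕ) k) → vars h ≡ allFin k →
            1 ≤ symbols h → bind (lookup Zs) h ≡ ζ → Join ζ →
            Decomposable P ⊎
            (Σ[ f ∈ (Fin k → ℕ) ] lookup Zs ≗ var ∘ f) × ListUnique.Unique (vars ζ)
    layer h Zs h-linear h-symbols refl z with renaming⊎symbol Zs
    ... | inj₂ (i , 1≤) = inj₁ (decomposable P h (lookup Zs) h-linear h-symbols z
                                 (symbol⇒smaller h (lookup Zs) h-linear i 1≤))
    ... | inj₁ (f , eq) with unique⊎duplicate (vars (bind (lookup Zs) h))
    ...   | inj₂ (_ , x∈ , 1<) = inj₁ (decomposable P h (lookup Zs) h-linear h-symbols z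
                                        (duplicate⇒smaller h (lookup Zs) h-linear f eq x∈ 1<))
    ...   | inj₁ ζ!            = inj₂ ((f , eq) , ζ!)

    analyse : ∀ ζ → Join ζ → CriticalPeak P ⊎ Decomposable P
    -- A variable has no symbols, so its only decoration is the bottom one.
    analyse (var x) z = contradiction var (¬bottom {var x} z)
    analyse ζ@(fn {k} f Zs) z
      with layer (fn f (Vec.tabulate var)) Zs (vars*-tabulate-var k) (s≤s z≤n)
                 (cong (fn f) (bind*-tabulate-var Zs)) z
    ... | inj₁ parts            = inj₂ parts
    ... | inj₂ ((_ , eq) , _) = contradiction (fn z≤n (mark*-renaming Zs eq)) (¬bottom {ζ} z)
    analyse ζ@(meta {k} p Zs) z
      with layer (meta p (Vec.tabulate var)) Zs (vars*-tabulate-var k) (s≤s z≤n)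
                 (cong (meta p) (bind*-tabulate-var Zs)) z
    ... | inj₁ parts             = inj₂ parts
    ... | inj₂ ((_ , eq) , ζ!) =
      let ξ , ξ-join , ξ≡ , _ = join-intro srcΦ srcΨ ζ (peak-zip P z)
          ζ≡full = trans (mark-renamed-pattern p Zs eq) (cong (full 1) (erase-join {ζ} z))
          -- Linearity of t, as criticality demands, is read off the join, which has the same
          -- variable occurrences.
          vars-ζ = trans (sym (Marking.vars-mark id ζ))
                     (trans (sym (vars-erase (mark ζ))) (cong vars (erase-join {ζ} z)))
      in inj₁ ( overlapping , (ξ , ξ-join , full-isTop ξ (trans ξ≡ ζ≡full))
              , subst ListUnique.Unique vars-ζ ζ!)

lemma4 : (Sym : ℕ → Set) →
    let open Rewriting Sym in
    (R : TRS) (leftLinear : LeftLinear R) →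
    let open Steps R leftLinear
        open Peak in
    (P : Peak) → OverlappingPeak P →
    CriticalPeak P ⊎
    (∃[ n ] Σ[ xs ∈ Vec ℕ n ] Σ[ P₀ ∈ Peak ] Σ[ Ps ∈ Vec Peak n ]
      (Unique xs
      × Φ P ≡ Φ P₀ [ xs ≔ₗ map Φ Ps ]
      × Ψ P ≡ Ψ P₀ [ xs ≔ₗ map Ψ Ps ]
      × s P ≡ s P₀ [ xs ≔ₜ map s Ps ]
      × t P ≡ t P₀ [ xs ≔ₜ map t Ps ]
      × u P ≡ u P₀ [ xs ≔ₜ map u Ps ]
      × ((i : Fin (suc n)) →
          P ⋒≥ lookup (P₀ ∷ Ps) i × P ⋓> lookup (P₀ ∷ Ps) i)))
lemma4 Sym R leftLinear = Peaks.critical⊎decomposable Sym R leftLinear
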